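{- Let $\mathcal{P}$ be the set of integer partitions satisfying all of the following: (i) no part repeats; (ii) adjacent parts do not differ by $1$ if the larger of the two is even; (iii) for every integer $j$, none of $(2j)+(2j+1)+(2j+3)$, $(2j)+(2j+2)+(2j+3)$, $(2j)+(2j+2)+(2j+4)$ occurs as a sub-partition; (iv) none of $1+3$, $2+3$, $2+4$ occurs as a sub-partition. Then, as formal power series in $q$, $$\sum_{\pi\in\mathcal{P}}q^{|\pi|}=\sum_{i,j,k\ge 0}(-1)^k\frac{q^{i^2+4ij+6ik+4j^2+12jk+12k^2+i-3j}}{(q;q)_i\,(q^4;q^4)_j\,(q^6;q^6)_k}.$$
   Context: Partitions are finite weakly increasing sequences of positive integers (the empty partition is included); $|\pi|$ is the sum of the parts of $\pi$. A sub-partition of a partition is a contiguous portion of it. For $n\ge 0$, $(a;q)_n=\prod_{0\le t<n}(1-aq^t)$. All identities are identities of formal power series. -}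

module Defs where

open import Data.Integer as ℤ using (ℤ; 0ℤ; 1ℤ; -1ℤ)
import Data.Integer.Properties as ℤₚ
open import Data.Integer.Tactic.RingSolver using (solve-∀)
open import Data.List using (List; []; _∷_; map; foldr; applyUpTo)
open import Data.List.Membership.Propositional using (_∉_)
open import Data.List.Relation.Binary.Infix.Heterogeneous using (Infix)
open import Data.List.Relation.Unary.All using (All)
open import Data.List.Relation.Unary.Linked using (Linked)
open import Data.List.Relation.Unary.Unique.Propositional using (Unique)
open import Data.Nat using (ℕ; zero; suc; _+_; _*_; _∸_; _≤_; _<_; _≟_)
open import Data.Nat.Divisibility using (_∣_)
open import Data.Product using (∃-syntax; _×_; _,_)
open import Level using (0ℓ)
open import Relation.Binary.PropositionalEquality
  using (_≡_; _≗_; trans; cong; module ≡-Reasoning)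
open import Relation.Nullary using (¬_; yes; no)
open import Relation.Unary using (Pred)

-- Partitions

Partition : Pred (List ℕ) 0ℓ
Partition π = All (0 <_) π × Linked _≤_ π

infix 4 _occursIn_
_occursIn_ : List ℕ → List ℕ → Set
σ occursIn π = Infix _≡_ σ π

-- In (iii) the index j ranges over ℕ: for negative j the smallest term 2j is
-- negative, so the pattern cannot occur in a list of positive parts.
record 𝒫 (π : List ℕ) : Set where
  field
    partition  : Partition π
    i-distinct : Unique π
    ii-gap     : Linked (λ x y → y ≡ x + 1 → ¬ (2 ∣ y)) π
    iii-a      : ∀ j → ¬ (2 * j ∷ 2 * j + 1 ∷ 2 * j + 3 ∷ [] occursIn π)
    iii-b      : ∀ j → ¬ (2 * j ∷ 2 * j + 2 ∷ 2 * j + 3 ∷ [] occursIn π)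
    iii-c      : ∀ j → ¬ (2 * j ∷ 2 * j + 2 ∷ 2 * j + 4 ∷ [] occursIn π)
    iv-a       : ¬ (1 ∷ 3 ∷ [] occursIn π)
    iv-b       : ¬ (2 ∷ 3 ∷ [] occursIn π)
    iv-c       : ¬ (2 ∷ 4 ∷ [] occursIn π)

-- Formal power series in q over ℤ: the value at n is the coefficient of qⁿ.

Series : Set
Series = ℕ → ℤ

sumℤ : List ℤ → ℤ
sumℤ = foldr ℤ._+_ 0ℤ

q^_ : ℕ → Series
(q^ m) n with n ≟ m
... | yes _ = 1ℤ
... | no  _ = 0ℤ

one : Series
one = q^ 0

infixl 6 _⊖_
_⊖_ : Series → Series → Series
(f ⊖ g) n = f n ℤ.- g n

infixr 7 _·_
_·_ : ℤ → Series → Series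
(c · f) n = c ℤ.* f n

infixl 7 _⊛_
_⊛_ : Series → Series → Series
(f ⊛ g) n = sumℤ (applyUpTo (λ i → f i ℤ.* g (n ∸ i)) (suc n))

infixr 8 _↑_
_↑_ : Series → ℕ → Series
f ↑ zero  = one
f ↑ suc t = (f ↑ t) ⊛ f

-- Drops the constant term and divides by q.
tail : Series → Series
tail f n = f (suc n)

-- Long division, meaningful when g has constant term 1; see ⊘-⊛.
infixl 7 _⊘_
_⊘_ : Series → Series → Series
(f ⊘ g) zero    = f 0
(f ⊘ g) (suc n) = ((tail f ⊖ f 0 · tail g) ⊘ g) n

⊘-⊛ : ∀ f g → g 0 ≡ 1ℤ → (f ⊘ g) ⊛ g ≗ f
⊘-⊛ f g g₀≡1 zero = begin
  f 0 ℤ.* g 0 ℤ.+ 0ℤ  ≡⟨ ℤₚ.+-identityʳ _ ⟩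
  f 0 ℤ.* g 0         ≡⟨ cong (f 0 ℤ.*_) g₀≡1 ⟩
  f 0 ℤ.* 1ℤ          ≡⟨ ℤₚ.*-identityʳ _ ⟩
  f 0                 ∎
  where open ≡-Reasoning
⊘-⊛ f g g₀≡1 (suc n) = trans
  (cong (λ z → f 0 ℤ.* g (suc n) ℤ.+ z)
        (⊘-⊛ (tail f ⊖ f 0 · tail g) g g₀≡1 n))
  (cancel (f 0 ℤ.* g (suc n)) (f (suc n)))
  where
  cancel : ∀ a b → a ℤ.+ (b ℤ.- a) ≡ b
  cancel = solve-∀

-- poch a b n is (a; b)_n.
poch : Series → Series → ℕ → Series
poch a b zero    = one
poch a b (suc n) = poch a b n ⊛ (one ⊖ a ⊛ (b ↑ n))

-- HasSum P f S: the family (f x) indexed by the x satisfying P is summable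
-- with sum S, i.e. for each n all but finitely many of the f x have
-- vanishing qⁿ-coefficient, and the remaining coefficients add up to S n.
HasSum : {I : Set} → Pred I 0ℓ → (I → Series) → Series → Set
HasSum {I} P f S = ∀ n → ∃[ F ]
    Unique F
  × All P F
  × (∀ x → P x → x ∉ F → f x n ≡ 0ℤ)
  × sumℤ (map (λ x → f x n) F) ≡ S n

-- The truncated subtraction is exact, because 3j ≤ 4j² for every natural j.
exponent : ℕ → ℕ → ℕ → ℕ
exponent i j k =
  (i * i + 4 * i * j + 6 * i * k + 4 * j * j + 12 * j * k + 12 * k * k + i)
  ∸ 3 * j

-- The denominator has constant term 1.
summand : ℕ × ℕ × ℕ → Series
summand (i , j , k) =
  ((-1ℤ ℤ.^ k) · (q^ exponent i j k))
  ⊘ (poch (q^ 1) (q^ 1) i ⊛ poch (q^ 4) (q^ 4) j ⊛ poch (q^ 6) (q^ 6) k)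

{-# OPTIONS --safe #-}

-- Write S A B C for the triple sum whose exponent is the quadratic form of the
-- statement plus Ai + Bj + Ck. Shifting i, j or k gives three contiguous
-- relations between such series. On the other side let Wₘ count the admissible
-- lists with all parts at least m, without the condition (iv). Removing the part m
-- (and, for even m, a part m+1 or m+2 after it) gives
--   Wₘ = Wₘ₊₁ + qᵐ Wₘ₊₂                                               (m odd),
--   Wₘ = Wₘ₊₁ + qᵐ (Wₘ₊₃ + qᵐ⁺¹ Wₘ₊₄ + qᵐ⁺² Wₘ₊₅)                     (m even),
-- and these recurrences, with Wₘ → 1, determine the Wₘ. The contiguous relations
-- show that W₁₊₂ₙ = S (2n) (1+4n) (6n) and W₂₊₂ₙ = S (1+2n) (1+4n) (6n) is the
-- solution. Condition (iv) says that a part 0 may be put in front, so the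
-- partitions in 𝒫 are counted by W₃ + q W₄ + q² W₅, which the same relations
-- identify with the triple sum S 1 (-3) 0 of the statement.
module Submission where

open import Defs
open import Data.Integer as ℤ using (ℤ; 0ℤ; 1ℤ; -1ℤ)
import Data.Integer.Properties as ℤₚ
import Data.Integer.Tactic.RingSolver as ℤ-Solver
open import Data.List using (List; []; _∷_; _++_; sum; applyUpTo; map; length; upTo; cartesianProduct)
open import Data.List.Membership.Propositional using (_∈_; _∉_)
open import Data.List.Membership.Propositional.Properties
  using (∈-++⁻; ∈-++⁺ˡ; ∈-++⁺ʳ; ∈-map⁺; ∈-map⁻; ∈-upTo⁺; ∈-cartesianProduct⁺)
import Data.List.Properties as Listₚ
open import Data.List.Relation.Binary.Infix.Heterogeneous using (here; there)
open import Data.List.Relation.Binary.Prefix.Heterogeneous using ([]; _∷_)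
open import Data.List.Relation.Unary.All as All using (All; []; _∷_)
import Data.List.Relation.Unary.AllPairs as AllPairs
open import Data.List.Relation.Unary.Any using (here)
open import Data.List.Relation.Unary.Linked as Linked using (Linked; []; [-]; _∷_)
open import Data.List.Relation.Unary.Linked.Properties using (Linked⇒AllPairs)
open import Data.List.Relation.Unary.Unique.Propositional using (Unique)
import Data.List.Relation.Unary.Unique.Propositional.Properties as Uniqueₚ
open import Data.Nat using (ℕ; zero; suc; _+_; _*_; _∸_; _≤_; _<_; z≤n; s≤s; _≟_)
open import Data.Nat.Divisibility using (_∣_; divides; _∣?_; ∣m+n∣m⇒∣n; ∣1⇒≡1; n∣m*n)
import Data.Nat.Properties as ℕₚ
import Data.Nat.Tactic.RingSolver as ℕ-Solver
open import Data.Product using (∃-syntax; _×_; _,_; proj₁; proj₂)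
open import Data.Sum using (_⊎_; inj₁; inj₂)
open import Data.Unit using (tt)
open import Function using (_∘_)
open import Level using (0ℓ)
import Relation.Binary.Reasoning.Setoid as SetoidReasoning
open import Relation.Binary.PropositionalEquality
open import Relation.Nullary using (¬_; yes; no; contradiction)
open import Relation.Unary using (U; Pred; _⊆_; _∪_)

module ≗-Reasoning = SetoidReasoning (ℕ →-setoid ℤ)

-- The Cauchy product

infixl 6 _⊕_
_⊕_ : Series → Series → Series
(f ⊕ g) n = f n ℤ.+ g n

-- `(f ⊛ g) (suc n)` computes to `f 0 ℤ.* g (suc n) ℤ.+ (tail f ⊛ g) n`, so laws of the product go
-- by induction on the coefficient index, with the series left arbitrary.
⊛-cong : ∀ {f f′ g g′} → f ≗ f′ → g ≗ g′ → f ⊛ g ≗ f′ ⊛ g′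
⊛-cong p r zero    = cong₂ (λ a b → a ℤ.* b ℤ.+ 0ℤ) (p 0) (r 0)
⊛-cong p r (suc n) = cong₂ ℤ._+_ (cong₂ ℤ._*_ (p 0) (r (suc n)))
                                 (⊛-cong (p ∘ suc) r n)

⊛-distribʳ-⊕ : ∀ f g h → (f ⊕ g) ⊛ h ≗ f ⊛ h ⊕ g ⊛ h
⊛-distribʳ-⊕ f g h zero = lemma (f 0) (g 0) (h 0)
  where
  lemma : ∀ a b c → (a ℤ.+ b) ℤ.* c ℤ.+ 0ℤ ≡ (a ℤ.* c ℤ.+ 0ℤ) ℤ.+ (b ℤ.* c ℤ.+ 0ℤ)
  lemma = ℤ-Solver.solve-∀
⊛-distribʳ-⊕ f g h (suc n)
  rewrite ⊛-distribʳ-⊕ (tail f) (tail g) h n = lemma (f 0) (g 0) (h (suc n)) _ _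
  where
  lemma : ∀ a b c x y →
          (a ℤ.+ b) ℤ.* c ℤ.+ (x ℤ.+ y) ≡ (a ℤ.* c ℤ.+ x) ℤ.+ (b ℤ.* c ℤ.+ y)
  lemma = ℤ-Solver.solve-∀

·-⊛ : ∀ c f g → (c · f) ⊛ g ≗ c · (f ⊛ g)
·-⊛ c f g zero = lemma c (f 0) (g 0)
  where
  lemma : ∀ c a b → c ℤ.* a ℤ.* b ℤ.+ 0ℤ ≡ c ℤ.* (a ℤ.* b ℤ.+ 0ℤ)
  lemma = ℤ-Solver.solve-∀
·-⊛ c f g (suc n) rewrite ·-⊛ c (tail f) g n = lemma c (f 0) (g (suc n)) _
  where
  lemma : ∀ c a b x → c ℤ.* a ℤ.* b ℤ.+ c ℤ.* x ≡ c ℤ.* (a ℤ.* b ℤ.+ x)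
  lemma = ℤ-Solver.solve-∀

-- `tail (f ⊛ g)` is `f 0 · tail g ⊕ tail f ⊛ g`, so distributivity and scalar multiples reduce the
-- step to associativity for `tail f`.
⊛-assoc : ∀ f g h → (f ⊛ g) ⊛ h ≗ f ⊛ (g ⊛ h)
⊛-assoc f g h zero = lemma (f 0) (g 0) (h 0)
  where
  lemma : ∀ a b c → (a ℤ.* b ℤ.+ 0ℤ) ℤ.* c ℤ.+ 0ℤ ≡ a ℤ.* (b ℤ.* c ℤ.+ 0ℤ) ℤ.+ 0ℤ
  lemma = ℤ-Solver.solve-∀
⊛-assoc f g h (suc n) = begin
  (f 0 ℤ.* g 0 ℤ.+ 0ℤ) ℤ.* h (suc n) ℤ.+ ((f 0 · tail g ⊕ tail f ⊛ g) ⊛ h) n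
    ≡⟨ cong (λ x → (f 0 ℤ.* g 0 ℤ.+ 0ℤ) ℤ.* h (suc n) ℤ.+ x)
         (trans (⊛-distribʳ-⊕ (f 0 · tail g) (tail f ⊛ g) h n)
                (cong₂ ℤ._+_ (·-⊛ (f 0) (tail g) h n) (⊛-assoc (tail f) g h n))) ⟩
  _ ≡⟨ lemma (f 0) (g 0) (h (suc n)) _ _ ⟩
  f 0 ℤ.* (g 0 ℤ.* h (suc n) ℤ.+ (tail g ⊛ h) n) ℤ.+ (tail f ⊛ (g ⊛ h)) n ∎
  where
  open ≡-Reasoning
  lemma : ∀ a b c x y → (a ℤ.* b ℤ.+ 0ℤ) ℤ.* c ℤ.+ (a ℤ.* x ℤ.+ y)
                      ≡ a ℤ.* (b ℤ.* c ℤ.+ x) ℤ.+ y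
  lemma = ℤ-Solver.solve-∀

-- The product unfolds along its left factor; splitting off the last summand instead gives the
-- mirrored recursion that commutativity needs.
⊛-sucʳ : ∀ f g n → (f ⊛ g) (suc n) ≡ f (suc n) ℤ.* g 0 ℤ.+ (f ⊛ tail g) n
⊛-sucʳ f g zero = lemma (f 0) (f 1) (g 0) (g 1)
  where
  lemma : ∀ a a′ b b′ → a ℤ.* b′ ℤ.+ (a′ ℤ.* b ℤ.+ 0ℤ) ≡ a′ ℤ.* b ℤ.+ (a ℤ.* b′ ℤ.+ 0ℤ)
  lemma = ℤ-Solver.solve-∀
⊛-sucʳ f g (suc n) =
  trans (cong (λ x → f 0 ℤ.* g (suc (suc n)) ℤ.+ x) (⊛-sucʳ (tail f) g n))
        (lemma (f 0 ℤ.* g (suc (suc n))) (f (suc (suc n)) ℤ.* g 0) _)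
  where
  lemma : ∀ a b c → a ℤ.+ (b ℤ.+ c) ≡ b ℤ.+ (a ℤ.+ c)
  lemma = ℤ-Solver.solve-∀

⊛-comm : ∀ f g → f ⊛ g ≗ g ⊛ f
⊛-comm f g zero    = cong (ℤ._+ 0ℤ) (ℤₚ.*-comm (f 0) (g 0))
⊛-comm f g (suc n) =
  trans (cong₂ ℤ._+_ (ℤₚ.*-comm (f 0) (g (suc n))) (⊛-comm (tail f) g n))
        (sym (⊛-sucʳ g f n))

⊛-swap : ∀ f g h → (f ⊛ g) ⊛ h ≗ (f ⊛ h) ⊛ g
⊛-swap f g h = begin
  (f ⊛ g) ⊛ h  ≈⟨ ⊛-assoc f g h ⟩
  f ⊛ (g ⊛ h)  ≈⟨ ⊛-cong {f} (λ _ → refl) (⊛-comm g h) ⟩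
  f ⊛ (h ⊛ g)  ≈⟨ ⊛-assoc f h g ⟨
  (f ⊛ h) ⊛ g  ∎
  where open ≗-Reasoning

-- Multiplication by powers of q

infixr 7 _▷_
-- Multiplication by qᵐ as a shift of coefficients, a form that computes; `q^-⊛` ties it to the
-- Cauchy product.
_▷_ : ℕ → Series → Series
zero  ▷ f = f
(suc m ▷ f) zero    = 0ℤ
(suc m ▷ f) (suc n) = (m ▷ f) n

▷-cong : ∀ m {f g} → f ≗ g → m ▷ f ≗ m ▷ g
▷-cong zero    p n       = p n
▷-cong (suc m) p zero    = refl
▷-cong (suc m) p (suc n) = ▷-cong m p n

▷-+ : ∀ m k f → m ▷ k ▷ f ≗ (m + k) ▷ f
▷-+ zero    k f n       = refl
▷-+ (suc m) k f zero    = refl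
▷-+ (suc m) k f (suc n) = ▷-+ m k f n

▷-⊕ : ∀ m f g → m ▷ (f ⊕ g) ≗ m ▷ f ⊕ m ▷ g
▷-⊕ zero    f g n       = refl
▷-⊕ (suc m) f g zero    = refl
▷-⊕ (suc m) f g (suc n) = ▷-⊕ m f g n

▷-· : ∀ m c f → m ▷ (c · f) ≗ c · (m ▷ f)
▷-· zero    c f n       = refl
▷-· (suc m) c f zero    = sym (ℤₚ.*-zeroʳ c)
▷-· (suc m) c f (suc n) = ▷-· m c f n

▷-< : ∀ {m n} f → n < m → (m ▷ f) n ≡ 0ℤ
▷-< {suc m} {zero}  f _         = refl
▷-< {suc m} {suc n} f (s≤s n<m) = ▷-< f n<m

▷-index : ∀ m f n → (m ▷ f) (m + n) ≡ f n
▷-index zero    f n = refl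
▷-index (suc m) f n = ▷-index m f n

▷-⊛ : ∀ m f g → (m ▷ f) ⊛ g ≗ m ▷ (f ⊛ g)
▷-⊛ zero    f g n       = refl
▷-⊛ (suc m) f g zero    = refl
▷-⊛ (suc m) f g (suc n) = trans (ℤₚ.+-identityˡ _) (▷-⊛ m f g n)

⊛-identityˡ : ∀ f → one ⊛ f ≗ f
⊛-identityˡ f zero    = lemma (f 0)
  where
  lemma : ∀ a → 1ℤ ℤ.* a ℤ.+ 0ℤ ≡ a
  lemma = ℤ-Solver.solve-∀
⊛-identityˡ f (suc n) = trans (cong (ℤ._+_ (1ℤ ℤ.* f (suc n))) (zeroˡ n)) (lemma (f (suc n)))
  where
  lemma : ∀ a → 1ℤ ℤ.* a ℤ.+ 0ℤ ≡ a
  lemma = ℤ-Solver.solve-∀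
  zeroˡ : ∀ n → (tail one ⊛ f) n ≡ 0ℤ
  zeroˡ zero    = refl
  zeroˡ (suc n) = trans (ℤₚ.+-identityˡ _) (zeroˡ n)

⊛-identityʳ : ∀ f → f ⊛ one ≗ f
⊛-identityʳ f n = trans (⊛-comm f one n) (⊛-identityˡ f n)

q^-refl : ∀ n → (q^ n) n ≡ 1ℤ
q^-refl n with n ≟ n
... | yes _  = refl
... | no n≢n = contradiction refl n≢n

q^-≢ : ∀ {m n} → n ≢ m → (q^ m) n ≡ 0ℤ
q^-≢ {m} {n} n≢m with n ≟ m
... | yes n≡m = contradiction n≡m n≢m
... | no _    = refl

q^-suc : ∀ m n → (q^ suc m) (suc n) ≡ (q^ m) n
q^-suc m n with n ≟ m
... | yes refl = q^-refl (suc n)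
... | no n≢m   = q^-≢ (n≢m ∘ ℕₚ.suc-injective)

q^-▷ : ∀ m → q^ m ≗ m ▷ one
q^-▷ zero    n       = refl
q^-▷ (suc m) zero    = refl
q^-▷ (suc m) (suc n) = trans (q^-suc m n) (q^-▷ m n)

q^-⊛ : ∀ m f → q^ m ⊛ f ≗ m ▷ f
q^-⊛ m f = begin
  q^ m ⊛ f       ≈⟨ ⊛-cong {g = f} (q^-▷ m) (λ _ → refl) ⟩
  (m ▷ one) ⊛ f  ≈⟨ ▷-⊛ m one f ⟩
  m ▷ (one ⊛ f)  ≈⟨ ▷-cong m (⊛-identityˡ f) ⟩
  m ▷ f          ∎
  where open ≗-Reasoning

q^-↑ : ∀ m t → (q^ m) ↑ t ≗ q^ (t * m)
q^-↑ m zero    _ = refl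
q^-↑ m (suc t) = begin
  (q^ m) ↑ t ⊛ q^ m     ≈⟨ ⊛-comm ((q^ m) ↑ t) (q^ m) ⟩
  q^ m ⊛ (q^ m) ↑ t     ≈⟨ q^-⊛ m _ ⟩
  m ▷ (q^ m) ↑ t        ≈⟨ ▷-cong m (q^-↑ m t) ⟩
  m ▷ q^ (t * m)        ≈⟨ ▷-cong m (q^-▷ (t * m)) ⟩
  m ▷ (t * m) ▷ one     ≈⟨ ▷-+ m (t * m) one ⟩
  (m + t * m) ▷ one     ≈⟨ q^-▷ (m + t * m) ⟨
  q^ (m + t * m)        ∎
  where open ≗-Reasoning

-- Long division

-- Since `g 0 ≡ 1ℤ`, the constant terms agree; then `tail h` is a quotient of the dividend with
-- which long division continues.
⊘-unique : ∀ {f g h} → g 0 ≡ 1ℤ → h ⊛ g ≗ f → h ≗ f ⊘ g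
⊘-unique {f} {g} {h} g₀ eq zero = begin
  h 0                  ≡⟨ ℤₚ.*-identityʳ (h 0) ⟨
  h 0 ℤ.* 1ℤ           ≡⟨ cong (h 0 ℤ.*_) g₀ ⟨
  h 0 ℤ.* g 0          ≡⟨ ℤₚ.+-identityʳ _ ⟨
  h 0 ℤ.* g 0 ℤ.+ 0ℤ   ≡⟨ eq 0 ⟩
  f 0                  ∎
  where open ≡-Reasoning
⊘-unique {f} {g} {h} g₀ eq (suc n) = ⊘-unique {h = tail h} g₀ rest n
  where
  h₀≡f₀ : h 0 ≡ f 0
  h₀≡f₀ = ⊘-unique {f} {g} {h} g₀ eq 0
  cancel : ∀ a b → b ≡ (a ℤ.+ b) ℤ.- a
  cancel = ℤ-Solver.solve-∀
  rest : tail h ⊛ g ≗ tail f ⊖ f 0 · tail g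
  rest k = trans (cancel (h 0 ℤ.* g (suc k)) _)
                 (cong₂ (λ x y → x ℤ.- y ℤ.* g (suc k)) (eq (suc k)) h₀≡f₀)

-- Turns `summand` into a signed shift of a reciprocal, the shape in which `term` is written.
·▷-⊘ : ∀ c m g → g 0 ≡ 1ℤ → (c · (q^ m)) ⊘ g ≗ c · (m ▷ (one ⊘ g))
·▷-⊘ c m g g₀ n = sym (⊘-unique {h = c · (m ▷ (one ⊘ g))} g₀ quotient n)
  where
  open ≗-Reasoning
  quotient : (c · (m ▷ (one ⊘ g))) ⊛ g ≗ c · (q^ m)
  quotient = begin
    (c · (m ▷ (one ⊘ g))) ⊛ g  ≈⟨ ·-⊛ c (m ▷ (one ⊘ g)) g ⟩
    c · ((m ▷ (one ⊘ g)) ⊛ g)  ≈⟨ cong (c ℤ.*_) ∘ ▷-⊛ m (one ⊘ g) g ⟩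
    c · (m ▷ ((one ⊘ g) ⊛ g))  ≈⟨ cong (c ℤ.*_) ∘ ▷-cong m (⊘-⊛ one g g₀) ⟩
    c · (m ▷ one)              ≈⟨ cong (c ℤ.*_) ∘ q^-▷ m ⟨
    c · (q^ m)                 ∎

-- With v = 1/g, the product of v - qᵐv = (1 - qᵐ)v and f is vg = 1, so v - qᵐv is 1/f. Every
-- contiguous relation rests on this.
⊘-factor : ∀ {f g} m → f 0 ≡ 1ℤ → g 0 ≡ 1ℤ → g ≗ f ⊛ (one ⊖ (q^ m)) →
           one ⊘ g ≗ one ⊘ f ⊕ m ▷ (one ⊘ g)
⊘-factor {f} {g} m f₀ g₀ eq n =
  trans (split (v n) ((m ▷ v) n)) (cong (ℤ._+ (m ▷ v) n) (⊘-unique {h = v ⊖ m ▷ v} f₀ quotient n))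
  where
  open ≗-Reasoning
  v u : Series
  v = one ⊘ g
  u = one ⊖ (q^ m)
  split : ∀ a b → a ≡ (a ℤ.- b) ℤ.+ b
  split = ℤ-Solver.solve-∀
  minus : ∀ a b → a ℤ.- b ≡ a ℤ.+ -1ℤ ℤ.* b
  minus = ℤ-Solver.solve-∀
  factor : v ⊖ m ▷ v ≗ u ⊛ v
  factor = begin
    v ⊖ m ▷ v                      ≈⟨ (λ k → minus (v k) ((m ▷ v) k)) ⟩
    v ⊕ -1ℤ · (m ▷ v)              ≈⟨ (λ k → cong₂ ℤ._+_ (⊛-identityˡ v k) (cong (-1ℤ ℤ.*_) (q^-⊛ m v k))) ⟨
    one ⊛ v ⊕ -1ℤ · (q^ m ⊛ v)     ≈⟨ (λ k → cong (ℤ._+_ ((one ⊛ v) k)) (·-⊛ -1ℤ (q^ m) v k)) ⟨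
    one ⊛ v ⊕ (-1ℤ · (q^ m)) ⊛ v   ≈⟨ ⊛-distribʳ-⊕ one (-1ℤ · (q^ m)) v ⟨
    (one ⊕ -1ℤ · (q^ m)) ⊛ v       ≈⟨ ⊛-cong {g = v} (λ k → minus (one k) ((q^ m) k)) (λ _ → refl) ⟨
    u ⊛ v                          ∎
  quotient : (v ⊖ m ▷ v) ⊛ f ≗ one
  quotient = begin
    (v ⊖ m ▷ v) ⊛ f  ≈⟨ ⊛-cong {g = f} factor (λ _ → refl) ⟩
    (u ⊛ v) ⊛ f      ≈⟨ ⊛-cong {g = f} (⊛-comm u v) (λ _ → refl) ⟩
    (v ⊛ u) ⊛ f      ≈⟨ ⊛-swap v u f ⟩
    (v ⊛ f) ⊛ u      ≈⟨ ⊛-assoc v f u ⟩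
    v ⊛ (f ⊛ u)      ≈⟨ ⊛-cong {v} (λ _ → refl) eq ⟨
    v ⊛ g            ≈⟨ ⊘-⊛ one g g₀ ⟩
    one              ∎

-- Reciprocals of the denominators

denominator : ℕ → ℕ → ℕ → Series
denominator i j k = poch (q^ 1) (q^ 1) i ⊛ poch (q^ 4) (q^ 4) j ⊛ poch (q^ 6) (q^ 6) k

⊛-constant : ∀ f g → f 0 ≡ 1ℤ → g 0 ≡ 1ℤ → (f ⊛ g) 0 ≡ 1ℤ
⊛-constant f g f₀ g₀ rewrite f₀ | g₀ = refl

poch-constant : ∀ m n → poch (q^ suc m) (q^ suc m) n 0 ≡ 1ℤ
poch-constant m zero    = refl
poch-constant m (suc n) = ⊛-constant
  (poch (q^ suc m) (q^ suc m) n) (one ⊖ (q^ suc m) ⊛ ((q^ suc m) ↑ n)) (poch-constant m n) refl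

denominator-constant : ∀ i j k → denominator i j k 0 ≡ 1ℤ
denominator-constant i j k =
  ⊛-constant (poch (q^ 1) (q^ 1) i ⊛ poch (q^ 4) (q^ 4) j) (poch (q^ 6) (q^ 6) k)
    (⊛-constant (poch (q^ 1) (q^ 1) i) (poch (q^ 4) (q^ 4) j)
      (poch-constant 0 i) (poch-constant 3 j))
    (poch-constant 5 k)

poch-suc : ∀ m n → poch (q^ m) (q^ m) (suc n) ≗ poch (q^ m) (q^ m) n ⊛ (one ⊖ (q^ (suc n * m)))
poch-suc m n = ⊛-cong {poch (q^ m) (q^ m) n} (λ _ → refl)
  (λ k → cong (ℤ._-_ (one k)) (trans (⊛-comm (q^ m) ((q^ m) ↑ n) k) (q^-↑ m (suc n) k)))

denominator-sucⁱ : ∀ i j k → denominator (suc i) j k ≗ denominator i j k ⊛ (one ⊖ (q^ (suc i * 1)))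
denominator-sucⁱ i j k = begin
  poch (q^ 1) (q^ 1) (suc i) ⊛ b ⊛ c  ≈⟨ ⊛-cong {g = c} (⊛-cong {g = b} (poch-suc 1 i) λ _ → refl) (λ _ → refl) ⟩
  a ⊛ u ⊛ b ⊛ c                       ≈⟨ ⊛-cong {g = c} (⊛-swap a u b) (λ _ → refl) ⟩
  a ⊛ b ⊛ u ⊛ c                       ≈⟨ ⊛-swap (a ⊛ b) u c ⟩
  a ⊛ b ⊛ c ⊛ u                       ∎
  where
  open ≗-Reasoning
  a b c u : Series
  a = poch (q^ 1) (q^ 1) i
  b = poch (q^ 4) (q^ 4) j
  c = poch (q^ 6) (q^ 6) k
  u = one ⊖ (q^ (suc i * 1))

denominator-sucʲ : ∀ i j k → denominator i (suc j) k ≗ denominator i j k ⊛ (one ⊖ (q^ (suc j * 4)))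
denominator-sucʲ i j k = begin
  a ⊛ poch (q^ 4) (q^ 4) (suc j) ⊛ c  ≈⟨ ⊛-cong {g = c} (⊛-cong {a} (λ _ → refl) (poch-suc 4 j)) (λ _ → refl) ⟩
  a ⊛ (b ⊛ u) ⊛ c                     ≈⟨ ⊛-cong {g = c} (⊛-assoc a b u) (λ _ → refl) ⟨
  a ⊛ b ⊛ u ⊛ c                       ≈⟨ ⊛-swap (a ⊛ b) u c ⟩
  a ⊛ b ⊛ c ⊛ u                       ∎
  where
  open ≗-Reasoning
  a b c u : Series
  a = poch (q^ 1) (q^ 1) i
  b = poch (q^ 4) (q^ 4) j
  c = poch (q^ 6) (q^ 6) k
  u = one ⊖ (q^ (suc j * 4))

denominator-sucᵏ : ∀ i j k → denominator i j (suc k) ≗ denominator i j k ⊛ (one ⊖ (q^ (suc k * 6)))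
denominator-sucᵏ i j k = begin
  a ⊛ poch (q^ 6) (q^ 6) (suc k)  ≈⟨ ⊛-cong {a} (λ _ → refl) (poch-suc 6 k) ⟩
  a ⊛ (c ⊛ u)                     ≈⟨ ⊛-assoc a c u ⟨
  a ⊛ c ⊛ u                       ∎
  where
  open ≗-Reasoning
  a c u : Series
  a = poch (q^ 1) (q^ 1) i ⊛ poch (q^ 4) (q^ 4) j
  c = poch (q^ 6) (q^ 6) k
  u = one ⊖ (q^ (suc k * 6))

inverse : ℕ → ℕ → ℕ → Series
inverse i j k = one ⊘ denominator i j k

inverse-sucⁱ : ∀ i j k → inverse (suc i) j k ≗ inverse i j k ⊕ (suc i * 1) ▷ inverse (suc i) j k
inverse-sucⁱ i j k =
  ⊘-factor (suc i * 1) (denominator-constant i j k) (denominator-constant (suc i) j k)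
           (denominator-sucⁱ i j k)

inverse-sucʲ : ∀ i j k → inverse i (suc j) k ≗ inverse i j k ⊕ (suc j * 4) ▷ inverse i (suc j) k
inverse-sucʲ i j k =
  ⊘-factor (suc j * 4) (denominator-constant i j k) (denominator-constant i (suc j) k)
           (denominator-sucʲ i j k)

inverse-sucᵏ : ∀ i j k → inverse i j (suc k) ≗ inverse i j k ⊕ (suc k * 6) ▷ inverse i j (suc k)
inverse-sucᵏ i j k =
  ⊘-factor (suc k * 6) (denominator-constant i j k) (denominator-constant i j (suc k))
           (denominator-sucᵏ i j k)

-- Sums of families of series

sum-cong : ∀ {f g : ℕ → ℤ} → f ≗ g → ∀ K → sumℤ (applyUpTo f K) ≡ sumℤ (applyUpTo g K)
sum-cong p zero    = refl
sum-cong p (suc K) = cong₂ ℤ._+_ (p 0) (sum-cong (p ∘ suc) K)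

sum-zero : ∀ {f : ℕ → ℤ} → (∀ i → f i ≡ 0ℤ) → ∀ K → sumℤ (applyUpTo f K) ≡ 0ℤ
sum-zero p zero    = refl
sum-zero p (suc K) rewrite p 0 = trans (ℤₚ.+-identityˡ _) (sum-zero (p ∘ suc) K)

sum-+ : ∀ (f g : ℕ → ℤ) K → sumℤ (applyUpTo (λ i → f i ℤ.+ g i) K)
                          ≡ sumℤ (applyUpTo f K) ℤ.+ sumℤ (applyUpTo g K)
sum-+ f g zero    = refl
sum-+ f g (suc K) rewrite sum-+ (f ∘ suc) (g ∘ suc) K = lemma (f 0) (g 0) _ _
  where
  lemma : ∀ a b x y → (a ℤ.+ b) ℤ.+ (x ℤ.+ y) ≡ (a ℤ.+ x) ℤ.+ (b ℤ.+ y)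
  lemma = ℤ-Solver.solve-∀

sum-truncate : ∀ {f : ℕ → ℤ} K L → (∀ i → K ≤ i → f i ≡ 0ℤ) →
               sumℤ (applyUpTo f (K + L)) ≡ sumℤ (applyUpTo f K)
sum-truncate         zero    L p = sum-zero (λ i → p i z≤n) L
sum-truncate {f = f} (suc K) L p =
  cong (ℤ._+_ (f 0)) (sum-truncate K L (λ i K≤i → p (suc i) (s≤s K≤i)))

-- The coefficients of total g are those of the sum of the family g provided
-- that g is Summable.
total : (ℕ → Series) → Series
total g n = sumℤ (applyUpTo (λ i → g i n) (suc n))

Summable : (ℕ → Series) → Set
Summable g = ∀ i n → n < i → g i n ≡ 0ℤ

total-cong : ∀ (f g : ℕ → Series) → (∀ i → f i ≗ g i) → total f ≗ total g
total-cong f g p n = sum-cong (λ i → p i n) (suc n)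

total-zero : ∀ (g : ℕ → Series) n → (∀ i → g i n ≡ 0ℤ) → total g n ≡ 0ℤ
total-zero g n p = sum-zero p (suc n)

-- For m ≤ n the coefficient in question is that of index n - m, to which only the indices i ≤ n - m
-- contribute; `n < m + K` says that K terms include all of them.
▷-total : ∀ m {g : ℕ → Series} → Summable g → ∀ K n → n < m + K →
          sumℤ (applyUpTo (λ i → (m ▷ g i) n) K) ≡ (m ▷ total g) n
▷-total m {g} sg K n n<m+K with m ℕₚ.≤? n
... | no m≰n = trans (sum-zero (λ i → ▷-< (g i) (ℕₚ.≰⇒> m≰n)) K)
                     (sym (▷-< (total g) (ℕₚ.≰⇒> m≰n)))
... | yes m≤n with ℕₚ.m≤n⇒∃[o]m+o≡n m≤n
... | r , refl with ℕₚ.m≤n⇒∃[o]m+o≡n (ℕₚ.+-cancelˡ-< m r K n<m+K)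
... | d , refl = begin
  sumℤ (applyUpTo (λ i → (m ▷ g i) (m + r)) (suc r + d))
    ≡⟨ sum-cong (λ i → ▷-index m (g i) r) (suc r + d) ⟩
  sumℤ (applyUpTo (λ i → g i r) (suc r + d))
    ≡⟨ sum-truncate (suc r) d (λ i r<i → sg i r r<i) ⟩
  total g r
    ≡⟨ ▷-index m (total g) r ⟨
  (m ▷ total g) (m + r) ∎
  where open ≡-Reasoning

total-map : ∀ m (f f′ g : ℕ → Series) → Summable g →
            (∀ i → f i ≗ f′ i ⊕ m ▷ g i) → total f ≗ total f′ ⊕ m ▷ total g
total-map m f f′ g sg p n = begin
  total f n
    ≡⟨ total-cong f _ p n ⟩
  total (λ i → f′ i ⊕ m ▷ g i) n
    ≡⟨ sum-+ (λ i → f′ i n) (λ i → (m ▷ g i) n) (suc n) ⟩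
  total f′ n ℤ.+ total (λ i → m ▷ g i) n
    ≡⟨ cong (ℤ._+_ (total f′ n)) (▷-total m sg (suc n) n (ℕₚ.m≤n+m (suc n) m)) ⟩
  total f′ n ℤ.+ (m ▷ total g) n ∎
  where open ≡-Reasoning

-- Setting the term of index 0 apart leaves n of the suc n terms. That is enough for g, because the
-- shift is positive.
total-suc : ∀ m (f f′ g : ℕ → Series) → Summable g → f 0 ≗ f′ 0 →
            (∀ i → f (suc i) ≗ f′ (suc i) ⊕ suc m ▷ g i) →
            total f ≗ total f′ ⊕ suc m ▷ total g
total-suc m f f′ g sg p₀ p n = begin
  f 0 n ℤ.+ sumℤ (applyUpTo (λ i → f (suc i) n) n)
    ≡⟨ cong₂ ℤ._+_ (p₀ n) (sum-cong (λ i → p i n) n) ⟩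
  f′ 0 n ℤ.+ sumℤ (applyUpTo (λ i → f′ (suc i) n ℤ.+ (suc m ▷ g i) n) n)
    ≡⟨ cong (ℤ._+_ (f′ 0 n)) (sum-+ (λ i → f′ (suc i) n) (λ i → (suc m ▷ g i) n) n) ⟩
  f′ 0 n ℤ.+ (sumℤ (applyUpTo (λ i → f′ (suc i) n) n)
              ℤ.+ sumℤ (applyUpTo (λ i → (suc m ▷ g i) n) n))
    ≡⟨ ℤₚ.+-assoc (f′ 0 n) _ _ ⟨
  total f′ n ℤ.+ sumℤ (applyUpTo (λ i → (suc m ▷ g i) n) n)
    ≡⟨ cong (ℤ._+_ (total f′ n)) (▷-total (suc m) sg n n (s≤s (ℕₚ.m≤n+m n m))) ⟩
  total f′ n ℤ.+ (suc m ▷ total g) n ∎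
  where open ≡-Reasoning

-- The triple sums

-- Arbitrary functions, so that `exponent` with its truncated subtraction is covered along with the
-- polynomials `quadratic A B C`.
Exponents : Set
Exponents = ℕ → ℕ → ℕ → ℕ

sign : ℕ → ℤ
sign k = -1ℤ ℤ.^ k

term : Exponents → ℕ → ℕ → ℕ → Series
term e i j k = sign k · (e i j k ▷ inverse i j k)

sum₁ : Exponents → ℕ → ℕ → Series
sum₁ e i j = total (term e i j)

sum₂ : Exponents → ℕ → Series
sum₂ e i = total (sum₁ e i)

-- Opaque, so that equations between triple sums are not compared by unfolding.
opaque
  sum₃ : Exponents → Series
  sum₃ e = total (sum₂ e)

  sum₃-total : ∀ e → sum₃ e ≗ total (sum₂ e)
  sum₃-total e _ = refl

-- Confines the contributions to the coefficient of qⁿ to indices at most n, so that the iterated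
-- `total` is the true triple sum.
Dominates : Exponents → Set
Dominates e = ∀ i j k → i ≤ e i j k × j ≤ e i j k × k ≤ e i j k

term-< : ∀ e i j k {n} → n < e i j k → term e i j k n ≡ 0ℤ
term-< e i j k n<e =
  trans (cong (sign k ℤ.*_) (▷-< (inverse i j k) n<e)) (ℤₚ.*-zeroʳ (sign k))

module _ (e : Exponents) (dom : Dominates e) where

  summable-sum₂ : Summable (sum₂ e)
  summable-sum₂ i n n<i = total-zero (sum₁ e i) n λ j → total-zero (term e i j) n λ k →
    term-< e i j k (ℕₚ.<-≤-trans n<i (proj₁ (dom i j k)))

  summable-sum₁ : ∀ i → Summable (sum₁ e i)
  summable-sum₁ i j n n<j = total-zero (term e i j) n λ k →
    term-< e i j k (ℕₚ.<-≤-trans n<j (proj₁ (proj₂ (dom i j k))))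

  summable-term : ∀ i j → Summable (term e i j)
  summable-term i j k n n<k = term-< e i j k (ℕₚ.<-≤-trans n<k (proj₂ (proj₂ (dom i j k))))

term-cong : ∀ e e′ i j k → e i j k ≡ e′ i j k → term e i j k ≗ term e′ i j k
term-cong e e′ i j k eq n rewrite eq = refl

-- Multiply v = w + q^d v by q^a. In the uses v and w are the reciprocals after and before one index
-- is raised, and the exponent of w is split as m + c.
▷-step : ∀ v w a b d m c → v ≗ w ⊕ d ▷ v → b ≡ d + a → a ≡ m + c →
         a ▷ v ≗ b ▷ v ⊕ m ▷ c ▷ w
▷-step v w a b d m c eq refl refl n = begin
  (a ▷ v) n                          ≡⟨ ▷-cong a eq n ⟩
  (a ▷ (w ⊕ d ▷ v)) n                ≡⟨ ▷-⊕ a w (d ▷ v) n ⟩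
  (a ▷ w) n ℤ.+ (a ▷ d ▷ v) n        ≡⟨ cong (ℤ._+_ ((a ▷ w) n)) (▷-+ a d v n) ⟩
  (a ▷ w) n ℤ.+ ((a + d) ▷ v) n      ≡⟨ cong (λ x → (a ▷ w) n ℤ.+ (x ▷ v) n) (ℕₚ.+-comm a d) ⟩
  (a ▷ w) n ℤ.+ (b ▷ v) n            ≡⟨ ℤₚ.+-comm ((a ▷ w) n) _ ⟩
  (b ▷ v) n ℤ.+ (a ▷ w) n            ≡⟨ cong (ℤ._+_ ((b ▷ v) n)) (▷-+ m c w n) ⟨
  (b ▷ v) n ℤ.+ (m ▷ c ▷ w) n        ∎
  where open ≡-Reasoning

·▷-step : ∀ s v w a b d m c → v ≗ w ⊕ d ▷ v → b ≡ d + a → a ≡ m + c →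
          s · (a ▷ v) ≗ s · (b ▷ v) ⊕ m ▷ (s · (c ▷ w))
·▷-step s v w a b d m c eq p r n = begin
  s ℤ.* (a ▷ v) n                                 ≡⟨ cong (s ℤ.*_) (▷-step v w a b d m c eq p r n) ⟩
  s ℤ.* ((b ▷ v) n ℤ.+ (m ▷ c ▷ w) n)             ≡⟨ ℤₚ.*-distribˡ-+ s _ _ ⟩
  s ℤ.* (b ▷ v) n ℤ.+ s ℤ.* (m ▷ c ▷ w) n         ≡⟨ cong (ℤ._+_ (s ℤ.* (b ▷ v) n)) (▷-· m s (c ▷ w) n) ⟨
  s ℤ.* (b ▷ v) n ℤ.+ (m ▷ (s · (c ▷ w))) n       ∎
  where open ≡-Reasoning

module _ (e e′ e″ : Exponents) (m : ℕ) (dom : Dominates e″) where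

  opaque
    unfolding sum₃

    -- Passing from e to e′ multiplies each term by qⁱ, so the difference carries (1 - qⁱ)/(q;q)ᵢ.
    -- This vanishes at i = 0 and is 1/(q;q)ᵢ₋₁ otherwise; lowering i by one gives the sum for e″.
    contiguousⁱ : (∀ i j k → e′ i j k ≡ i * 1 + e i j k) →
                  (∀ i j k → e (suc i) j k ≡ suc m + e″ i j k) →
                  sum₃ e ≗ sum₃ e′ ⊕ suc m ▷ sum₃ e″
    contiguousⁱ p r =
      total-suc m (sum₂ e) (sum₂ e′) (sum₂ e″) (summable-sum₂ e″ dom)
        (total-cong (sum₁ e 0) (sum₁ e′ 0) λ j → total-cong (term e 0 j) (term e′ 0 j) λ k →
           term-cong e e′ 0 j k (sym (p 0 j k)))
        λ i → total-map (suc m) (sum₁ e (suc i)) (sum₁ e′ (suc i)) (sum₁ e″ i) (summable-sum₁ e″ dom i)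
        λ j → total-map (suc m) (term e (suc i) j) (term e′ (suc i) j) (term e″ i j) (summable-term e″ dom i j)
        λ k → ·▷-step (sign k) (inverse (suc i) j k) (inverse i j k) _ _ (suc i * 1) (suc m) (e″ i j k)
                (inverse-sucⁱ i j k) (p (suc i) j k) (r i j k)

    -- The same argument with 1 - q⁴ʲ, the last factor of the Pochhammer symbol in j.
    contiguousʲ : (∀ i j k → e′ i j k ≡ j * 4 + e i j k) →
                  (∀ i j k → e i (suc j) k ≡ suc m + e″ i j k) →
                  sum₃ e ≗ sum₃ e′ ⊕ suc m ▷ sum₃ e″
    contiguousʲ p r =
      total-map (suc m) (sum₂ e) (sum₂ e′) (sum₂ e″) (summable-sum₂ e″ dom)
        λ i → total-suc m (sum₁ e i) (sum₁ e′ i) (sum₁ e″ i) (summable-sum₁ e″ dom i)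
        (total-cong (term e i 0) (term e′ i 0) λ k → term-cong e e′ i 0 k (sym (p i 0 k)))
        λ j → total-map (suc m) (term e i (suc j)) (term e′ i (suc j)) (term e″ i j) (summable-term e″ dom i j)
        λ k → ·▷-step (sign k) (inverse i (suc j) k) (inverse i j k) _ _ (suc j * 4) (suc m) (e″ i j k)
                (inverse-sucʲ i j k) (p i (suc j) k) (r i j k)

    -- e and e′ change sides because of the sign (-1)ᵏ.
    contiguousᵏ : (∀ i j k → e′ i j k ≡ k * 6 + e i j k) →
                  (∀ i j k → e i j (suc k) ≡ suc m + e″ i j k) →
                  sum₃ e′ ≗ sum₃ e ⊕ suc m ▷ sum₃ e″
    contiguousᵏ p r =
      total-map (suc m) (sum₂ e′) (sum₂ e) (sum₂ e″) (summable-sum₂ e″ dom)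
        λ i → total-map (suc m) (sum₁ e′ i) (sum₁ e i) (sum₁ e″ i) (summable-sum₁ e″ dom i)
        λ j → total-suc m (term e′ i j) (term e i j) (term e″ i j) (summable-term e″ dom i j)
        (term-cong e′ e i j 0 (p i j 0))
        λ k n → trans
          (move (sign k) _ _ _
            (▷-step (inverse i j (suc k)) (inverse i j k) _ _ (suc k * 6) (suc m) (e″ i j k)
              (inverse-sucᵏ i j k) (p i j (suc k)) (r i j k) n))
          (cong (ℤ._+_ (term e i j (suc k) n))
            (sym (▷-· (suc m) (sign k) (e″ i j k ▷ inverse i j k) n)))
      where
      move : ∀ s a b c → a ≡ b ℤ.+ c →
             -1ℤ ℤ.* s ℤ.* b ≡ -1ℤ ℤ.* s ℤ.* a ℤ.+ s ℤ.* c
      move s _ b c refl = lemma s b c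
        where
        lemma : ∀ s b c → -1ℤ ℤ.* s ℤ.* b ≡ -1ℤ ℤ.* s ℤ.* (b ℤ.+ c) ℤ.+ s ℤ.* c
        lemma = ℤ-Solver.solve-∀

total-head : ∀ (g : ℕ → Series) n → (∀ i → g (suc i) n ≡ 0ℤ) → total g n ≡ g 0 n
total-head g n p = trans (cong (ℤ._+_ (g 0 n)) (sum-zero p n)) (ℤₚ.+-identityʳ _)

-- Triple sums with quadratic exponents

quadratic : ℕ → ℕ → ℕ → Exponents
quadratic A B C i j k =
  i * i + 4 * i * j + 6 * i * k + 4 * j * j + 12 * j * k + 12 * k * k + A * i + B * j + C * k

quadratic-sucⁱ : ∀ A B C i j k →
  quadratic A B C (suc i) j k ≡ suc A + quadratic (2 + A) (4 + B) (6 + C) i j k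
quadratic-sucⁱ = expand
  where
  expand : ∀ A B C i j k →
    suc i * suc i + 4 * suc i * j + 6 * suc i * k + 4 * j * j + 12 * j * k + 12 * k * k + A * suc i + B * j + C * k
    ≡ suc A + (i * i + 4 * i * j + 6 * i * k + 4 * j * j + 12 * j * k + 12 * k * k + (2 + A) * i + (4 + B) * j + (6 + C) * k)
  expand = ℕ-Solver.solve-∀

quadratic-sucʲ : ∀ A B C i j k →
  quadratic A B C i (suc j) k ≡ 4 + B + quadratic (4 + A) (8 + B) (12 + C) i j k
quadratic-sucʲ = expand
  where
  expand : ∀ A B C i j k →
    i * i + 4 * i * suc j + 6 * i * k + 4 * suc j * suc j + 12 * suc j * k + 12 * k * k + A * i + B * suc j + C * k
    ≡ 4 + B + (i * i + 4 * i * j + 6 * i * k + 4 * j * j + 12 * j * k + 12 * k * k + (4 + A) * i + (8 + B) * j + (12 + C) * k)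
  expand = ℕ-Solver.solve-∀

quadratic-sucᵏ : ∀ A B C i j k →
  quadratic A B C i j (suc k) ≡ 12 + C + quadratic (6 + A) (12 + B) (24 + C) i j k
quadratic-sucᵏ = expand
  where
  expand : ∀ A B C i j k →
    i * i + 4 * i * j + 6 * i * suc k + 4 * j * j + 12 * j * suc k + 12 * suc k * suc k + A * i + B * j + C * suc k
    ≡ 12 + C + (i * i + 4 * i * j + 6 * i * k + 4 * j * j + 12 * j * k + 12 * k * k + (6 + A) * i + (12 + B) * j + (24 + C) * k)
  expand = ℕ-Solver.solve-∀

m≤m² : ∀ m → m ≤ m * m
m≤m² zero    = z≤n
m≤m² (suc m) = ℕₚ.m≤m*n (suc m) (suc m)

quadratic-dominates : ∀ A B C → Dominates (quadratic A B C)
quadratic-dominates A B C i j k =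
  ℕₚ.≤-trans (ℕₚ.m≤n⇒m≤n+o _ (m≤m² i)) (ℕₚ.≤-reflexive (i-part A B C i j k)) ,
  ℕₚ.≤-trans (ℕₚ.m≤n⇒m≤n+o _ (m≤m² j)) (ℕₚ.≤-reflexive (j-part A B C i j k)) ,
  ℕₚ.≤-trans (ℕₚ.m≤n⇒m≤n+o _ (m≤m² k)) (ℕₚ.≤-reflexive (k-part A B C i j k))
  where
  i-part : ∀ A B C i j k →
    i * i + (4 * i * j + 6 * i * k + 4 * j * j + 12 * j * k + 12 * k * k + A * i + B * j + C * k)
    ≡ i * i + 4 * i * j + 6 * i * k + 4 * j * j + 12 * j * k + 12 * k * k + A * i + B * j + C * k
  i-part = ℕ-Solver.solve-∀
  j-part : ∀ A B C i j k →
    j * j + (i * i + 4 * i * j + 6 * i * k + 3 * j * j + 12 * j * k + 12 * k * k + A * i + B * j + C * k)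
    ≡ i * i + 4 * i * j + 6 * i * k + 4 * j * j + 12 * j * k + 12 * k * k + A * i + B * j + C * k
  j-part = ℕ-Solver.solve-∀
  k-part : ∀ A B C i j k →
    k * k + (i * i + 4 * i * j + 6 * i * k + 4 * j * j + 12 * j * k + 11 * k * k + A * i + B * j + C * k)
    ≡ i * i + 4 * i * j + 6 * i * k + 4 * j * j + 12 * j * k + 12 * k * k + A * i + B * j + C * k
  k-part = ℕ-Solver.solve-∀

S : ℕ → ℕ → ℕ → Series
S A B C = sum₃ (quadratic A B C)

S-contiguousⁱ : ∀ A B C → S A B C ≗ S (1 + A) B C ⊕ (1 + A) ▷ S (2 + A) (4 + B) (6 + C)
S-contiguousⁱ A B C =
  contiguousⁱ (quadratic A B C) (quadratic (1 + A) B C) (quadratic (2 + A) (4 + B) (6 + C)) A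
    (quadratic-dominates (2 + A) (4 + B) (6 + C)) (raise A B C) (quadratic-sucⁱ A B C)
  where
  raise : ∀ A B C i j k →
    i * i + 4 * i * j + 6 * i * k + 4 * j * j + 12 * j * k + 12 * k * k + (1 + A) * i + B * j + C * k
    ≡ i * 1 + (i * i + 4 * i * j + 6 * i * k + 4 * j * j + 12 * j * k + 12 * k * k + A * i + B * j + C * k)
  raise = ℕ-Solver.solve-∀

S-contiguousʲ : ∀ A B C → S A B C ≗ S A (4 + B) C ⊕ (4 + B) ▷ S (4 + A) (8 + B) (12 + C)
S-contiguousʲ A B C =
  contiguousʲ (quadratic A B C) (quadratic A (4 + B) C) (quadratic (4 + A) (8 + B) (12 + C)) (3 + B)
    (quadratic-dominates (4 + A) (8 + B) (12 + C)) (raise A B C) (quadratic-sucʲ A B C)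
  where
  raise : ∀ A B C i j k →
    i * i + 4 * i * j + 6 * i * k + 4 * j * j + 12 * j * k + 12 * k * k + A * i + (4 + B) * j + C * k
    ≡ j * 4 + (i * i + 4 * i * j + 6 * i * k + 4 * j * j + 12 * j * k + 12 * k * k + A * i + B * j + C * k)
  raise = ℕ-Solver.solve-∀

S-contiguousᵏ : ∀ A B C → S A B (6 + C) ≗ S A B C ⊕ (12 + C) ▷ S (6 + A) (12 + B) (24 + C)
S-contiguousᵏ A B C =
  contiguousᵏ (quadratic A B C) (quadratic A B (6 + C)) (quadratic (6 + A) (12 + B) (24 + C)) (11 + C)
    (quadratic-dominates (6 + A) (12 + B) (24 + C)) (raise A B C) (quadratic-sucᵏ A B C)
  where
  raise : ∀ A B C i j k →
    i * i + 4 * i * j + 6 * i * k + 4 * j * j + 12 * j * k + 12 * k * k + A * i + B * j + (6 + C) * k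
    ≡ k * 6 + (i * i + 4 * i * j + 6 * i * k + 4 * j * j + 12 * j * k + 12 * k * k + A * i + B * j + C * k)
  raise = ℕ-Solver.solve-∀

-- A positive index i, j or k brings the exponent to at least 1 + A, 4 + B or 12 + C, each above n.
-- Only the term at the origin is left, and it is 1. This is the initial condition of the
-- recurrences.
S-low : ∀ {A B C n} → n ≤ A → n ≤ 3 + B → n ≤ 11 + C → S A B C n ≡ one n
S-low {A} {B} {C} {n} n≤A n≤B n≤C = begin
  S A B C n            ≡⟨ sum₃-total e n ⟩
  total (sum₂ e) n     ≡⟨ total-head (sum₂ e) n (λ i → total-zero (sum₁ e (suc i)) n λ j → total-zero (term e (suc i) j) n λ k →
                            term-< e (suc i) j k (below n≤A (quadratic-sucⁱ A B C i j k))) ⟩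
  sum₂ e 0 n           ≡⟨ total-head (sum₁ e 0) n (λ j → total-zero (term e 0 (suc j)) n λ k →
                            term-< e 0 (suc j) k (below n≤B (quadratic-sucʲ A B C 0 j k))) ⟩
  sum₁ e 0 0 n         ≡⟨ total-head (term e 0 0) n (λ k →
                            term-< e 0 0 (suc k) (below n≤C (quadratic-sucᵏ A B C 0 0 k))) ⟩
  term e 0 0 0 n       ≡⟨ term-cong e (λ _ _ _ → 0) 0 0 0 (origin A B C) n ⟩
  1ℤ ℤ.* inverse 0 0 0 n  ≡⟨ ℤₚ.*-identityˡ _ ⟩
  inverse 0 0 0 n      ≡⟨ ⊘-unique {one} {one ⊛ one ⊛ one} {one} refl quotient n ⟨
  one n                ∎
  where
  open ≡-Reasoning
  e = quadratic A B C
  below : ∀ {a b x} → n ≤ a → x ≡ suc a + b → n < x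
  below n≤a refl = s≤s (ℕₚ.m≤n⇒m≤n+o _ n≤a)
  origin : ∀ A B C → A * 0 + B * 0 + C * 0 ≡ 0
  origin = ℕ-Solver.solve-∀
  quotient : one ⊛ (one ⊛ one ⊛ one) ≗ one
  quotient k = trans (⊛-identityˡ (one ⊛ one ⊛ one) k) (trans (⊛-identityʳ (one ⊛ one) k) (⊛-identityʳ one k))

-- The recurrences of the partition series

▷-contiguous : ∀ p f g m h → f ≗ g ⊕ m ▷ h → p ▷ f ≗ p ▷ g ⊕ (p + m) ▷ h
▷-contiguous p f g m h eq n =
  trans (▷-cong p eq n) (trans (▷-⊕ p g (m ▷ h) n) (cong (ℤ._+_ ((p ▷ g) n)) (▷-+ p m h n)))

▷-index-cong : ∀ {m m′} f n → m ≡ m′ → (m ▷ f) n ≡ (m′ ▷ f) n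
▷-index-cong f n refl = refl

-- At C = 3A the factor 1 - z³q³ᴬ⁺³ of the generating function in z is cancelled
-- against 1 - zqᴬ⁺¹, leaving 1 + zqᴬ⁺¹ + z²q²ᴬ⁺².
S-cancel : ∀ A B {C} → C ≡ A + (A + A) →
  S (1 + A) B C ≗ S (2 + A) B (6 + C) ⊕ (2 + A) ▷ S (4 + A) (4 + B) (12 + C)
                    ⊕ (2 + A + (4 + A)) ▷ S (6 + A) (8 + B) (18 + C)
S-cancel A B {C} eq n = combine
  {b = S₂ n} {d = ((2 + A) ▷ S₄) n} {f = ((2 + A + (4 + A)) ▷ S₆) n}
  (S-contiguousᵏ (1 + A) B C n)
  (S-contiguousⁱ (1 + A) B (6 + C) n)
  (▷-contiguous (2 + A) S₃ S₄ (4 + A) S₅ (S-contiguousⁱ (3 + A) (4 + B) (12 + C)) n)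
  (▷-contiguous (2 + A + (4 + A)) S₅ S₆ (6 + A) S₇ (S-contiguousⁱ (5 + A) (8 + B) (18 + C)) n)
  -- The remainder of three steps in i meets that of the step in k: 12 + C is the sum of 2 + A, 4 +
  -- A and 6 + A exactly when C = 3A.
  (▷-index-cong S₇ n (trans (cong (12 +_) eq) (index A)))
  where
  S₂ = S (2 + A) B (6 + C)
  S₃ = S (3 + A) (4 + B) (12 + C)
  S₄ = S (4 + A) (4 + B) (12 + C)
  S₅ = S (5 + A) (8 + B) (18 + C)
  S₆ = S (6 + A) (8 + B) (18 + C)
  S₇ = S (7 + A) (12 + B) (24 + C)
  index : ∀ A → 12 + (A + (A + A)) ≡ 2 + A + (4 + A) + (6 + A)
  index = ℕ-Solver.solve-∀
  combine : ∀ {a x g b c d e f g′} → a ≡ x ℤ.+ g → a ≡ b ℤ.+ c → c ≡ d ℤ.+ e →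
            e ≡ f ℤ.+ g′ → g ≡ g′ → x ≡ b ℤ.+ d ℤ.+ f
  combine {x = x} {g} {b} {d = d} {f = f} p refl refl refl refl =
    trans (undo x g) (trans (cong (ℤ._- g) (sym p)) (lemma b d f g))
    where
    undo : ∀ x g → x ≡ (x ℤ.+ g) ℤ.- g
    undo = ℤ-Solver.solve-∀
    lemma : ∀ b d f g → b ℤ.+ (d ℤ.+ (f ℤ.+ g)) ℤ.- g ≡ b ℤ.+ d ℤ.+ f
    lemma = ℤ-Solver.solve-∀

▷-⊕₂ : ∀ p f a g b h → p ▷ (f ⊕ a ▷ g ⊕ b ▷ h) ≗ p ▷ f ⊕ (p + a) ▷ g ⊕ (p + b) ▷ h
▷-⊕₂ p f a g b h n =
  trans (▷-⊕ p (f ⊕ a ▷ g) (b ▷ h) n)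
        (cong₂ ℤ._+_ (▷-contiguous p (f ⊕ a ▷ g) f a g (λ _ → refl) n) (▷-+ p b h n))

-- The recurrence for even m, at m = 2 + A. The relation in j is applied to each of the three series
-- of `S-cancel`. By B = 1 + 2A the three remainders are the expansion of S (5 + A) (8 + B) (12 + C)
-- by `S-cancel` at 4 + A, shifted by (2 + A) + (3 + A), and so combine into one series.
S-even : ∀ A {B C} → B ≡ 1 + (A + A) → C ≡ A + (A + A) →
  S (1 + A) B C ≗ S (2 + A) (4 + B) (6 + C) ⊕
    (2 + A) ▷ (S (4 + A) (8 + B) (12 + C) ⊕ (3 + A) ▷ S (5 + A) (8 + B) (12 + C)
                                          ⊕ (4 + A) ▷ S (6 + A) (12 + B) (18 + C))
S-even A {B} {C} refl eqC n = combine
  {y₁ = S A₂ B₄ C₆ n} {((2 + A) ▷ S A₄ B₈ C₁₂) n} {((2 + A + (4 + A)) ▷ S A₆ B₁₂ C₁₈) n}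
  (S-cancel A B eqC n)
  (S-contiguousʲ A₂ B C₆ n)
  (▷-contiguous (2 + A) (S A₄ B₄ C₁₂) (S A₄ B₈ C₁₂) (8 + B) (S A₈ B₁₂ C₂₄)
     (S-contiguousʲ A₄ B₄ C₁₂) n)
  (▷-contiguous (2 + A + (4 + A)) (S A₆ B₈ C₁₈) (S A₆ B₁₂ C₁₈) (12 + B) (S A₁₀ B₁₆ C₃₀)
     (S-contiguousʲ A₆ B₈ C₁₈) n)
  (trans (▷-cong (2 + A + (3 + A)) (S-cancel A₄ B₈ (trans (cong (12 +_) eqC) (index₀ A))) n)
         (▷-⊕₂ (2 + A + (3 + A)) (S A₆ B₈ C₁₈) (6 + A) (S A₈ B₁₂ C₂₄) (6 + A + (8 + A)) (S A₁₀ B₁₆ C₃₀) n))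
  (▷-index-cong (S A₆ B₈ C₁₈) n (index₁ A))
  (▷-index-cong (S A₈ B₁₂ C₂₄) n (index₂ A))
  (▷-index-cong (S A₁₀ B₁₆ C₃₀) n (index₃ A))
  (▷-⊕₂ (2 + A) (S A₄ B₈ C₁₂) (3 + A) (S (5 + A) B₈ C₁₂) (4 + A) (S A₆ B₁₂ C₁₈) n)
  where
  A₂ = 2 + A; A₄ = 4 + A; A₆ = 6 + A; A₈ = 8 + A; A₁₀ = 10 + A
  B₄ = 4 + B; B₈ = 8 + B; B₁₂ = 12 + B; B₁₆ = 16 + B
  C₆ = 6 + C; C₁₂ = 12 + C; C₁₈ = 18 + C; C₂₄ = 24 + C; C₃₀ = 30 + C
  index₀ : ∀ A → 12 + (A + (A + A)) ≡ 4 + A + (4 + A + (4 + A))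
  index₀ = ℕ-Solver.solve-∀
  index₁ : ∀ A → 4 + (1 + (A + A)) ≡ 2 + A + (3 + A)
  index₁ = ℕ-Solver.solve-∀
  index₂ : ∀ A → 2 + A + (4 + (4 + (1 + (A + A)))) ≡ 2 + A + (3 + A) + (6 + A)
  index₂ = ℕ-Solver.solve-∀
  index₃ : ∀ A → 2 + A + (4 + A) + (4 + (8 + (1 + (A + A)))) ≡ 2 + A + (3 + A) + (6 + A + (8 + A))
  index₃ = ℕ-Solver.solve-∀
  combine : ∀ {s x₁ x₂ x₃ y₁ y₂ y₃ u v w u′ v′ w′ z r} →
    s ≡ x₁ ℤ.+ x₂ ℤ.+ x₃ → x₁ ≡ y₁ ℤ.+ u → x₂ ≡ y₂ ℤ.+ v → x₃ ≡ y₃ ℤ.+ w →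
    z ≡ u′ ℤ.+ v′ ℤ.+ w′ → u ≡ u′ → v ≡ v′ → w ≡ w′ → r ≡ y₂ ℤ.+ z ℤ.+ y₃ →
    s ≡ y₁ ℤ.+ r
  combine {y₁ = y₁} {y₂} {y₃} {u} {v} {w} refl refl refl refl refl refl refl refl refl =
    lemma y₁ y₂ y₃ u v w
    where
    lemma : ∀ a b c u v w → (a ℤ.+ u) ℤ.+ (b ℤ.+ v) ℤ.+ (c ℤ.+ w)
                          ≡ a ℤ.+ (b ℤ.+ (u ℤ.+ v ℤ.+ w) ℤ.+ c)
    lemma = ℤ-Solver.solve-∀

-- The exponent of the statement

-- This is `quadratic-sucʲ` at A = 1, B = -3, C = 0. Exhibiting the summand 3(j + 1) lets the
-- truncated subtraction cancel it.
exponent-sucʲ : ∀ i j k → exponent i (suc j) k ≡ 1 + quadratic 5 5 12 i j k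
exponent-sucʲ i j k =
  trans (cong (_∸ 3 * suc j) (expand i j k)) (ℕₚ.m+n∸m≡n (3 * suc j) (1 + quadratic 5 5 12 i j k))
  where
  expand : ∀ i j k →
    i * i + 4 * i * suc j + 6 * i * k + 4 * suc j * suc j + 12 * suc j * k + 12 * k * k + i
    ≡ 3 * suc j + (1 + (i * i + 4 * i * j + 6 * i * k + 4 * j * j + 12 * j * k + 12 * k * k + 5 * i + 5 * j + 12 * k))
  expand = ℕ-Solver.solve-∀

exponent-zeroʲ : ∀ i k → exponent i 0 k ≡ quadratic 1 1 0 i 0 k
exponent-zeroʲ = expand
  where
  expand : ∀ i k → i * i + 4 * i * 0 + 6 * i * k + 4 * 0 * 0 + 12 * 0 * k + 12 * k * k + i
    ≡ i * i + 4 * i * 0 + 6 * i * k + 4 * 0 * 0 + 12 * 0 * k + 12 * k * k + 1 * i + 1 * 0 + 0 * k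
  expand = ℕ-Solver.solve-∀

exponent-dominates : Dominates exponent
exponent-dominates i zero    k = subst (λ e → i ≤ e × 0 ≤ e × k ≤ e)
  (sym (exponent-zeroʲ i k)) (quadratic-dominates 1 1 0 i 0 k)
exponent-dominates i (suc j) k = subst (λ e → i ≤ e × suc j ≤ e × k ≤ e)
  (sym (exponent-sucʲ i j k))
  (let i≤ , j≤ , k≤ = quadratic-dominates 5 5 12 i j k
   in ℕₚ.m≤n⇒m≤1+n i≤ , s≤s j≤ , ℕₚ.m≤n⇒m≤1+n k≤)

-- The relation in j at B = -3, derived separately because the parameters of `S` are natural
-- numbers.
exponent-contiguousʲ : sum₃ exponent ≗ S 1 1 0 ⊕ 1 ▷ S 5 5 12
exponent-contiguousʲ =
  contiguousʲ exponent (quadratic 1 1 0) (quadratic 5 5 12) 0 (quadratic-dominates 5 5 12) raise exponent-sucʲ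
  where
  raise : ∀ i j k → quadratic 1 1 0 i j k ≡ j * 4 + exponent i j k
  raise i zero    k = sym (exponent-zeroʲ i k)
  raise i (suc j) k = trans (expand i j k) (cong (suc j * 4 +_) (sym (exponent-sucʲ i j k)))
    where
    expand : ∀ i j k →
      i * i + 4 * i * suc j + 6 * i * k + 4 * suc j * suc j + 12 * suc j * k + 12 * k * k + 1 * i + 1 * suc j + 0 * k
      ≡ suc j * 4 + (1 + (i * i + 4 * i * j + 6 * i * k + 4 * j * j + 12 * j * k + 12 * k * k + 5 * i + 5 * j + 12 * k))
    expand = ℕ-Solver.solve-∀

-- A second expansion of W₄ besides `S-even`: it exhibits S 5 5 12, the remainder in
-- `exponent-contiguousʲ`, next to q⁴W₆ and q⁵W₇.
S-3-5-6 : S 3 5 6 ≗ S 5 5 12 ⊕ 4 ▷ S 5 9 12 ⊕ 5 ▷ S 6 13 18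
S-3-5-6 n = combine
  {b = (4 ▷ S 6 9 18) n} {(10 ▷ S 8 13 24) n} {S 5 5 12 n} {g = (5 ▷ S 6 13 18) n} {(18 ▷ S 10 17 30) n}
  (S-cancel 2 5 refl n)
  (S-contiguousⁱ 4 5 12 n)
  -- The last two terms of the first expansion, together with the remainder q¹⁸ S 10 17 30 of the
  -- relation in j, recombine into q⁴W₆.
  (trans (▷-cong 4 (S-cancel 4 9 refl) n) (▷-⊕₂ 4 (S 6 9 18) 6 (S 8 13 24) 14 (S 10 17 30) n))
  (▷-contiguous 5 (S 6 9 18) (S 6 13 18) 13 (S 10 17 30) (S-contiguousʲ 6 9 18) n)
  where
  combine : ∀ {s a b c d e f g h} → s ≡ a ℤ.+ b ℤ.+ c → a ≡ d ℤ.+ e → f ≡ b ℤ.+ c ℤ.+ h →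
            e ≡ g ℤ.+ h → s ≡ d ℤ.+ f ℤ.+ g
  combine {b = b} {c} {d} {g = g} {h} refl refl refl refl = lemma b c d g h
    where
    lemma : ∀ b c d g h → d ℤ.+ (g ℤ.+ h) ℤ.+ b ℤ.+ c ≡ d ℤ.+ (b ℤ.+ c ℤ.+ h) ℤ.+ g
    lemma = ℤ-Solver.solve-∀

-- The right-hand side is W₃ + qW₄ + q²W₅. On the left, S 1 1 0 = W₂ = W₃ + q²W₅ + q⁵W₆ + q⁶W₇, and
-- the last two terms join q S 5 5 12 to form qW₄.
sum₃-exponent : sum₃ exponent ≗ S 2 5 6 ⊕ 1 ▷ S 3 5 6 ⊕ 2 ▷ S 4 9 12
sum₃-exponent n = combine
  {b = (1 ▷ S 5 5 12) n} {S 2 5 6 n} {(2 ▷ S 4 9 12) n} {(5 ▷ S 5 9 12) n} {(6 ▷ S 6 13 18) n}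
  (exponent-contiguousʲ n)
  (S-even 0 refl refl n)
  (▷-⊕₂ 2 (S 4 9 12) 3 (S 5 9 12) 4 (S 6 13 18) n)
  (trans (▷-cong 1 S-3-5-6 n) (▷-⊕₂ 1 (S 5 5 12) 4 (S 5 9 12) 5 (S 6 13 18) n))
  where
  combine : ∀ {s a b c d e f g r} → s ≡ a ℤ.+ b → a ≡ c ℤ.+ r → r ≡ d ℤ.+ e ℤ.+ f →
            g ≡ b ℤ.+ e ℤ.+ f → s ≡ c ℤ.+ g ℤ.+ d
  combine {b = b} {c} {d} {e} {f} refl refl refl refl = lemma b c d e f
    where
    lemma : ∀ b c d e f → c ℤ.+ (d ℤ.+ e ℤ.+ f) ℤ.+ b ≡ c ℤ.+ (b ℤ.+ e ℤ.+ f) ℤ.+ d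
    lemma = ℤ-Solver.solve-∀

-- Admissible lists

mutual

  -- Free m: the admissible lists with all parts at least m.
  data Free (m : ℕ) : List ℕ → Set where
    []  : Free m []
    _∷_ : ∀ {c π} → m ≤ c → After c π → Free m (c ∷ π)

  -- After c: the admissible continuations of a list that ends with the part c,
  -- when c exceeds its predecessor by too much to take part in a forbidden triple.
  data After (c : ℕ) : List ℕ → Set where
    odd   : ∀ {π} → ¬ 2 ∣ c → Free (2 + c) π → After c π
    even  : ∀ {π} → 2 ∣ c → Free (3 + c) π → After c π
    even₁ : ∀ {π} → 2 ∣ c → Free (4 + c) π → After c (1 + c ∷ π)
    even₂ : ∀ {π} → 2 ∣ c → Free (5 + c) π → After c (2 + c ∷ π)

Step : ℕ → ℕ → Set
Step x y = x < y × (y ≡ x + 1 → ¬ 2 ∣ y)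

data Forbidden : ℕ → ℕ → ℕ → Set where
  forbidden-a : ∀ {x} → 2 ∣ x → Forbidden x (1 + x) (3 + x)
  forbidden-b : ∀ {x} → 2 ∣ x → Forbidden x (2 + x) (3 + x)
  forbidden-c : ∀ {x} → 2 ∣ x → Forbidden x (2 + x) (4 + x)

forbidden-2∣ : ∀ {x y z} → Forbidden x y z → 2 ∣ x
forbidden-2∣ (forbidden-a 2∣x) = 2∣x
forbidden-2∣ (forbidden-b 2∣x) = 2∣x
forbidden-2∣ (forbidden-c 2∣x) = 2∣x

-- This bound and the next two account for the thresholds 3 + c, 4 + c and 5 + c in `After`: beyond
-- them no forbidden triple can be completed.
forbidden-y : ∀ {x y z} → Forbidden x y z → y < 3 + x
forbidden-y (forbidden-a _) = ℕₚ.m≤n⇒m≤1+n ℕₚ.≤-refl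
forbidden-y (forbidden-b _) = ℕₚ.≤-refl
forbidden-y (forbidden-c _) = ℕₚ.≤-refl

forbidden-z₁ : ∀ {x z} → Forbidden x (1 + x) z → z < 4 + x
forbidden-z₁ (forbidden-a _) = ℕₚ.≤-refl

forbidden-z : ∀ {x y z} → Forbidden x y z → z < 5 + x
forbidden-z (forbidden-a _) = ℕₚ.n≤1+n _
forbidden-z (forbidden-b _) = ℕₚ.n≤1+n _
forbidden-z (forbidden-c _) = ℕₚ.≤-refl

Avoids : List ℕ → Set
Avoids π = ∀ {x y z} → Forbidden x y z → ¬ (x ∷ y ∷ z ∷ [] occursIn π)

2∤1 : ¬ 2 ∣ 1
2∤1 2∣1 with () ← ∣1⇒≡1 2∣1

2∣⇒2∤suc : ∀ {x} → 2 ∣ x → ¬ 2 ∣ 1 + x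
2∣⇒2∤suc {x} 2∣x 2∣1+x = 2∤1 (∣m+n∣m⇒∣n (subst (2 ∣_) (ℕₚ.+-comm 1 x) 2∣1+x) 2∣x)

2∤⇒2∣suc : ∀ {x} → ¬ 2 ∣ x → 2 ∣ suc x
2∤⇒2∣suc {zero}        2∤0 = contradiction (divides 0 refl) 2∤0
2∤⇒2∣suc {suc zero}    _   = divides 1 refl
2∤⇒2∣suc {suc (suc x)} 2∤x = 2+ (2∤⇒2∣suc (2∤x ∘ 2+))
  where
  2+ : ∀ {y} → 2 ∣ y → 2 ∣ 2 + y
  2+ (divides k refl) = divides (suc k) refl

mutual

  -- The next part exceeds l by at least two, so condition (ii) holds vacuously at this place.
  free-linked : ∀ {l m π} → l < m → Free (1 + m) π → Linked Step (l ∷ π)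
  free-linked l<m []      = [-]
  free-linked {l} {m} l<m (_∷_ {c} m<c r) =
    (ℕₚ.<-trans l<m m<c , λ { refl → contradiction (subst (m <_) (ℕₚ.+-comm l 1) m<c) (ℕₚ.≤⇒≯ l<m) })
    ∷ after-linked r

  after-linked : ∀ {c π} → After c π → Linked Step (c ∷ π)
  after-linked (odd _ f)  = free-linked ℕₚ.≤-refl f
  after-linked (even _ f) = free-linked (ℕₚ.m≤n⇒m≤1+n ℕₚ.≤-refl) f
  after-linked {c} (even₁ 2∣c f) =
    (ℕₚ.≤-refl , λ _ → 2∣⇒2∤suc 2∣c) ∷ free-linked (ℕₚ.m≤n⇒m≤1+n ℕₚ.≤-refl) f
  after-linked {c} (even₂ 2∣c f) =
    (ℕₚ.m≤n⇒m≤1+n ℕₚ.≤-refl , λ eq → contradiction (trans eq (ℕₚ.+-comm c 1)) ℕₚ.1+n≢n)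
    ∷ free-linked (ℕₚ.m≤n⇒m≤1+n ℕₚ.≤-refl) f

mutual

  free-avoids : ∀ {m π} → Free m π → Avoids π
  free-avoids []      _ (here ())
  free-avoids (_ ∷ r) = after-avoids r

  after-avoids : ∀ {c π} → After c π → Avoids (c ∷ π)
  after-avoids (odd 2∤c f)   bad (here (refl ∷ _))                 = 2∤c (forbidden-2∣ bad)
  after-avoids (odd _ f)     bad (there occ)                       = free-avoids f bad occ
  after-avoids (even _ [])  _   (here (_ ∷ ()))
  after-avoids (even _ (3+c≤y ∷ _)) bad (here (refl ∷ refl ∷ _))   = ℕₚ.<⇒≱ (forbidden-y bad) 3+c≤y
  after-avoids (even _ f)    bad (there occ)                       = free-avoids f bad occ
  after-avoids (even₁ _ []) _   (here (_ ∷ _ ∷ ()))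
  after-avoids (even₁ _ (4+c≤z ∷ _)) bad (here (refl ∷ refl ∷ refl ∷ _)) =
    ℕₚ.<⇒≱ (forbidden-z₁ bad) 4+c≤z
  after-avoids (even₁ 2∣c f) bad (there (here (refl ∷ _)))         = 2∣⇒2∤suc 2∣c (forbidden-2∣ bad)
  after-avoids (even₁ _ f)   bad (there (there occ))               = free-avoids f bad occ
  after-avoids (even₂ _ []) _   (here (_ ∷ _ ∷ ()))
  after-avoids (even₂ _ []) _   (there (here (_ ∷ ())))
  after-avoids (even₂ _ (5+c≤z ∷ _)) bad (here (refl ∷ refl ∷ refl ∷ _)) =
    ℕₚ.<⇒≱ (forbidden-z bad) 5+c≤z
  -- Here 2 + c is even and could itself begin a forbidden triple; since 5 + c = 3 + (2 + c), the
  -- next part is already too large.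
  after-avoids (even₂ _ (5+c≤y ∷ _)) bad (there (here (refl ∷ refl ∷ _))) =
    ℕₚ.<⇒≱ (forbidden-y bad) 5+c≤y
  after-avoids (even₂ _ f)   bad (there (there occ))               = free-avoids f bad occ

avoids-tail : ∀ {x π} → Avoids (x ∷ π) → Avoids π
avoids-tail av bad occ = av bad (there occ)

-- The converse of `after-linked` and `after-avoids`, by the parity of c and its gap to the next
-- part. Condition (ii) rules out a gap of 1 below an even part; after c and 1 + c or 2 + c, the
-- forbidden triples rule out the remaining small values of the third part.
after : ∀ c π → Linked Step (c ∷ π) → Avoids (c ∷ π) → After c π
after c π ls av with 2 ∣? c
after c [] ls av | no 2∤c = odd 2∤c []
after c (d ∷ π) ((c<d , gap) ∷ ls) av | no 2∤c =
  odd 2∤c (ℕₚ.≤∧≢⇒< c<d 1+c≢d ∷ after d π ls (avoids-tail av))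
  where
  1+c≢d : suc c ≢ d
  1+c≢d refl = gap (ℕₚ.+-comm 1 c) (2∤⇒2∣suc 2∤c)
after c [] ls av | yes 2∣c = even 2∣c []
after c (d ∷ π) ((c<d , gap) ∷ ls) av | yes 2∣c with suc c ≟ d | 2 + c ≟ d
after c (d ∷ []) _ av | yes 2∣c | yes refl | _ = even₁ 2∣c []
after c (d ∷ e ∷ π) (_ ∷ (d<e , gap) ∷ ls) av | yes 2∣c | yes refl | _ =
  even₁ 2∣c (ℕₚ.≤∧≢⇒< (ℕₚ.≤∧≢⇒< d<e 2+c≢e) 3+c≢e ∷ after e π ls (avoids-tail (avoids-tail av)))
  where
  2+c≢e : 2 + c ≢ e
  2+c≢e refl = gap (cong suc (ℕₚ.+-comm 1 c)) (2∤⇒2∣suc (2∣⇒2∤suc 2∣c))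
  3+c≢e : 3 + c ≢ e
  3+c≢e refl = av (forbidden-a 2∣c) (here (refl ∷ refl ∷ refl ∷ []))
after c (d ∷ []) _ av | yes 2∣c | no _ | yes refl = even₂ 2∣c []
after c (d ∷ e ∷ π) (_ ∷ (d<e , gap) ∷ ls) av | yes 2∣c | no _ | yes refl =
  even₂ 2∣c (ℕₚ.≤∧≢⇒< (ℕₚ.≤∧≢⇒< d<e 3+c≢e) 4+c≢e ∷ after e π ls (avoids-tail (avoids-tail av)))
  where
  3+c≢e : 3 + c ≢ e
  3+c≢e refl = av (forbidden-b 2∣c) (here (refl ∷ refl ∷ refl ∷ []))
  4+c≢e : 4 + c ≢ e
  4+c≢e refl = av (forbidden-c 2∣c) (here (refl ∷ refl ∷ refl ∷ []))
after c (d ∷ π) ((c<d , gap) ∷ ls) av | yes 2∣c | no 1+c≢d | no 2+c≢d =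
  even 2∣c (ℕₚ.≤∧≢⇒< (ℕₚ.≤∧≢⇒< c<d 1+c≢d) 2+c≢d ∷ after d π ls (avoids-tail av))

-- Partitions in 𝒫 as continuations of a part 0

𝒫⇒linked : ∀ {π} → Linked _≤_ π → Unique π → Linked (λ x y → y ≡ x + 1 → ¬ (2 ∣ y)) π → Linked Step π
𝒫⇒linked []       _                        _          = []
𝒫⇒linked [-]      _                        _          = [-]
𝒫⇒linked (p ∷ ps) ((x≢y ∷ _) AllPairs.∷ u) (gap ∷ gs) =
  (ℕₚ.≤∧≢⇒< p x≢y , gap) ∷ 𝒫⇒linked ps u gs

-- Divisibility by 2 yields the form j * 2, whereas condition (iii) is stated with 2 * j.
triple≡ : ∀ j u v → _≡_ {A = List ℕ} (j * 2 ∷ u + j * 2 ∷ v + j * 2 ∷ [])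
                                     (2 * j ∷ 2 * j + u ∷ 2 * j + v ∷ [])
triple≡ j u v = commute (ℕₚ.*-comm j 2)
  where
  commute : ∀ {x y} → x ≡ y → _≡_ {A = List ℕ} (x ∷ u + x ∷ v + x ∷ []) (y ∷ y + u ∷ y + v ∷ [])
  commute {x} refl = cong₂ {C = List ℕ} (λ s t → x ∷ s ∷ t ∷ []) (ℕₚ.+-comm u x) (ℕₚ.+-comm v x)

-- A triple that begins with the added 0 is 0+1+3, 0+2+3 or 0+2+4, and its last two entries form a
-- pair excluded by (iv). Any other triple lies in π and falls under (iii).
𝒫⇒after : 𝒫 ⊆ After 0
𝒫⇒after {π} p = after 0 π (cons (proj₁ partition) (𝒫⇒linked (proj₂ partition) i-distinct ii-gap)) avoids
  where
  open 𝒫 p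
  cons : ∀ {π} → All (0 <_) π → Linked Step π → Linked Step (0 ∷ π)
  cons []        _  = [-]
  cons (0<d ∷ _) ls = (0<d , λ { refl → 2∤1 }) ∷ ls
  avoids : Avoids (0 ∷ π)
  avoids (forbidden-a _) (here (refl ∷ occ)) = iv-a (here occ)
  avoids (forbidden-b _) (here (refl ∷ occ)) = iv-b (here occ)
  avoids (forbidden-c _) (here (refl ∷ occ)) = iv-c (here occ)
  avoids (forbidden-a (divides j refl)) (there occ) = iii-a j (subst (_occursIn π) (triple≡ j 1 3) occ)
  avoids (forbidden-b (divides j refl)) (there occ) = iii-b j (subst (_occursIn π) (triple≡ j 2 3) occ)
  avoids (forbidden-c (divides j refl)) (there occ) = iii-c j (subst (_occursIn π) (triple≡ j 2 4) occ)

free-≤ : ∀ {m π} → Free m π → All (m ≤_) π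
free-≤ []        = []
free-≤ (m≤c ∷ r) = m≤c ∷ All.map (ℕₚ.≤-trans m≤c ∘ ℕₚ.<⇒≤)
  (AllPairs.head (Linked⇒AllPairs ℕₚ.<-trans (Linked.map proj₁ (after-linked r))))

occurs-head : ∀ {P : Pred ℕ 0ℓ} {x σ π} → All P π → x ∷ σ occursIn π → P x
occurs-head (px ∷ _)  (here (refl ∷ _)) = px
occurs-head (_ ∷ pxs) (there occ)       = occurs-head pxs occ

-- The two bounds cover 1+3, 2+3 and 2+4 together. After 0, a part 1 is followed only by parts from
-- 4 on, a part 2 only by parts from 5 on, and no other part is below 3.
after-0-avoids : ∀ {π x y} → After 0 π → x ≤ 2 → y ≤ 2 + x → ¬ (x ∷ y ∷ [] occursIn π)
after-0-avoids (odd 2∤0 _)               _   _     _   = 2∤0 (divides 0 refl)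
after-0-avoids (even _ f)                x≤2 _     occ = ℕₚ.<⇒≱ (occurs-head (free-≤ f) occ) x≤2
after-0-avoids (even₁ _ [])              _   _     (here (_ ∷ ()))
after-0-avoids (even₁ _ (4≤y ∷ _))       _   y≤3   (here (refl ∷ refl ∷ [])) = ℕₚ.<⇒≱ 4≤y y≤3
after-0-avoids (even₁ _ f)               x≤2 _     (there occ) =
  ℕₚ.<⇒≱ (ℕₚ.<⇒≤ (occurs-head (free-≤ f) occ)) x≤2
after-0-avoids (even₂ _ [])              _   _     (here (_ ∷ ()))
after-0-avoids (even₂ _ (5≤y ∷ _))       _   y≤4   (here (refl ∷ refl ∷ [])) = ℕₚ.<⇒≱ 5≤y y≤4
after-0-avoids (even₂ _ f)               x≤2 _     (there occ) =
  ℕₚ.<⇒≱ (ℕₚ.<⇒≤ (ℕₚ.<⇒≤ (occurs-head (free-≤ f) occ))) x≤2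

after⇒𝒫 : After 0 ⊆ 𝒫
after⇒𝒫 {π} r = record
  { partition  = AllPairs.head increasing , Linked.map (ℕₚ.<⇒≤ ∘ proj₁) (Linked.tail linked)
  ; i-distinct = AllPairs.map ℕₚ.<⇒≢ (AllPairs.tail increasing)
  ; ii-gap     = Linked.map proj₂ (Linked.tail linked)
  ; iii-a      = λ j → avoids (forbidden-a (divides j refl)) ∘ subst (_occursIn π) (sym (triple≡ j 1 3))
  ; iii-b      = λ j → avoids (forbidden-b (divides j refl)) ∘ subst (_occursIn π) (sym (triple≡ j 2 3))
  ; iii-c      = λ j → avoids (forbidden-c (divides j refl)) ∘ subst (_occursIn π) (sym (triple≡ j 2 4))
  ; iv-a       = after-0-avoids r (s≤s z≤n) ℕₚ.≤-refl
  ; iv-b       = after-0-avoids r ℕₚ.≤-refl (ℕₚ.n≤1+n 3)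
  ; iv-c       = after-0-avoids r ℕₚ.≤-refl ℕₚ.≤-refl
  }
  where
  linked     = after-linked r
  increasing = Linked⇒AllPairs ℕₚ.<-trans (Linked.map proj₁ linked)
  avoids : Avoids π
  avoids = avoids-tail (after-avoids r)

-- Counting

-- The number is an integer so that it can be a coefficient of a series. The enumeration is kept
-- because `HasSum` asks for the finite support itself.
Count : Pred (List ℕ) 0ℓ → ℕ → ℤ → Set
Count P n z = ∃[ F ]
    Unique F
  × (∀ {π} → π ∈ F → P π × sum π ≡ n)
  × (∀ {π} → P π → sum π ≡ n → π ∈ F)
  × ℤ.+ length F ≡ z

count-⇔ : ∀ {P R n z} → P ⊆ R → R ⊆ P → Count P n z → Count R n z
count-⇔ P⊆R R⊆P (F , u , sound , complete , len) =
  F , u , (λ π∈F → let p , s = sound π∈F in P⊆R p , s) , (λ r → complete (R⊆P r)) , len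

count-≡ : ∀ {P n z z′} → z ≡ z′ → Count P n z → Count P n z′
count-≡ refl count = count

count-∪ : ∀ {P R n z z′} → (∀ {π} → P π → ¬ R π) → Count P n z → Count R n z′ → Count (P ∪ R) n (z ℤ.+ z′)
count-∪ {P} {R} {n} disjoint (F , uF , soundF , completeF , refl) (G , uG , soundG , completeG , refl) =
  F ++ G ,
  Uniqueₚ.++⁺ uF uG (λ (x∈F , x∈G) → disjoint (proj₁ (soundF x∈F)) (proj₁ (soundG x∈G))) ,
  (λ π∈ → sound (∈-++⁻ F π∈)) ,
  complete ,
  trans (cong ℤ.+_ (Listₚ.length-++ F)) (ℤₚ.pos-+ (length F) (length G))
  where
  sound : ∀ {π} → π ∈ F ⊎ π ∈ G → (P ∪ R) π × sum π ≡ n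
  sound (inj₁ π∈F) = let p , s = soundF π∈F in inj₁ p , s
  sound (inj₂ π∈G) = let r , s = soundG π∈G in inj₂ r , s
  complete : ∀ {π} → (P ∪ R) π → sum π ≡ n → π ∈ F ++ G
  complete (inj₁ p) s = ∈-++⁺ˡ (completeF p s)
  complete (inj₂ r) s = ∈-++⁺ʳ F (completeG r s)

data Prepend (m : ℕ) (P : Pred (List ℕ) 0ℓ) : Pred (List ℕ) 0ℓ where
  prepend : ∀ {π} → P π → Prepend m P (m ∷ π)

-- The count of the remainders is requested only at r = n - m, which is where an induction on the
-- size can supply it.
count-Prepend : ∀ m {P n} f → (∀ r → m + r ≡ n → Count P r (f r)) → Count (Prepend m P) n ((m ▷ f) n)
count-Prepend m {P} {n} f count with m ℕₚ.≤? n
... | no m≰n =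
  [] , AllPairs.[] , (λ ()) ,
  (λ { {_ ∷ π} (prepend _) refl → contradiction (ℕₚ.m≤m+n m (sum π)) m≰n }) ,
  sym (▷-< f (ℕₚ.≰⇒> m≰n))
... | yes m≤n with ℕₚ.m≤n⇒∃[o]m+o≡n m≤n
... | r , refl with count r refl
... | F , u , sound , complete , len =
  map (m ∷_) F ,
  Uniqueₚ.map⁺ Listₚ.∷-injectiveʳ u ,
  sound′ ,
  (λ { {_ ∷ π} (prepend p) s → ∈-map⁺ (m ∷_) (complete p (ℕₚ.+-cancelˡ-≡ m (sum π) r s)) }) ,
  trans (cong ℤ.+_ (Listₚ.length-map (m ∷_) F)) (trans len (sym (▷-index m f r)))
  where
  sound′ : ∀ {π} → π ∈ map (m ∷_) F → Prepend m P π × sum π ≡ m + r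
  sound′ π∈ with ∈-map⁻ (m ∷_) π∈
  ... | _ , π′∈ , refl = let p , s = sound π′∈ in prepend p , cong (m +_) s

free-split : ∀ {m} → Free m ⊆ Free (1 + m) ∪ Prepend m (After m)
free-split []        = inj₁ []
free-split {m} (_∷_ {c} m≤c r) with m ≟ c
... | yes refl = inj₂ (prepend r)
... | no m≢c   = inj₁ (ℕₚ.≤∧≢⇒< m≤c m≢c ∷ r)

free-unsplit : ∀ {m} → Free (1 + m) ∪ Prepend m (After m) ⊆ Free m
free-unsplit (inj₁ [])           = []
free-unsplit (inj₁ (m<c ∷ r))    = ℕₚ.<⇒≤ m<c ∷ r
free-unsplit (inj₂ (prepend r))  = ℕₚ.≤-refl ∷ r

free-disjoint-Prepend : ∀ {c m P π} → c < m → Free m π → ¬ Prepend c P π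
free-disjoint-Prepend c<m (m≤c ∷ _) (prepend _) = ℕₚ.<⇒≱ c<m m≤c

count-Free : ∀ m {n} f g → Count (Free (1 + m)) n (f n) →
             (∀ r → m + r ≡ n → Count (After m) r (g r)) →
             Count (Free m) n ((f ⊕ m ▷ g) n)
count-Free m f g free rest = count-⇔ free-unsplit free-split
  (count-∪ (free-disjoint-Prepend ℕₚ.≤-refl) free (count-Prepend m g rest))

count-After-odd : ∀ {c n z} → ¬ 2 ∣ c → Count (Free (2 + c)) n z → Count (After c) n z
count-After-odd {c} 2∤c = count-⇔ (odd 2∤c) only
  where
  only : After c ⊆ Free (2 + c)
  only (odd _ f)     = f
  only (even 2∣c _)  = contradiction 2∣c 2∤c
  only (even₁ 2∣c _) = contradiction 2∣c 2∤c
  only (even₂ 2∣c _) = contradiction 2∣c 2∤c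

count-After-even : ∀ {c n} f g h → 2 ∣ c → Count (Free (3 + c)) n (f n) →
                   (∀ r → 1 + c + r ≡ n → Count (Free (4 + c)) r (g r)) →
                   (∀ r → 2 + c + r ≡ n → Count (Free (5 + c)) r (h r)) →
                   Count (After c) n ((f ⊕ (1 + c) ▷ g ⊕ (2 + c) ▷ h) n)
count-After-even {c} f g h 2∣c free next₁ next₂ = count-⇔ join split
  (count-∪ disjoint
    (count-∪ (free-disjoint-Prepend (ℕₚ.n≤1+n _)) free (count-Prepend (1 + c) g next₁))
    (count-Prepend (2 + c) h next₂))
  where
  Parts : Pred (List ℕ) 0ℓ
  Parts = (Free (3 + c) ∪ Prepend (1 + c) (Free (4 + c))) ∪ Prepend (2 + c) (Free (5 + c))
  join : Parts ⊆ After c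
  join (inj₁ (inj₁ f))           = even 2∣c f
  join (inj₁ (inj₂ (prepend f))) = even₁ 2∣c f
  join (inj₂ (prepend f))        = even₂ 2∣c f
  split : After c ⊆ Parts
  split (odd 2∤c _) = contradiction 2∣c 2∤c
  split (even _ f)  = inj₁ (inj₁ f)
  split (even₁ _ f) = inj₁ (inj₂ (prepend f))
  split (even₂ _ f) = inj₂ (prepend f)
  disjoint : ∀ {π} → (Free (3 + c) ∪ Prepend (1 + c) (Free (4 + c))) π → ¬ Prepend (2 + c) (Free (5 + c)) π
  disjoint (inj₁ f)           p = free-disjoint-Prepend ℕₚ.≤-refl f p
  disjoint (inj₂ (prepend _)) ()

-- A nonempty list with parts at least m has sum at least m > n, so only the empty list can occur.
count-Free-low : ∀ {m n} → n < m → Count (Free m) n (one n)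
count-Free-low {m} {zero} 0<m =
  [] ∷ [] , ([] AllPairs.∷ AllPairs.[]) , (λ { (here refl) → [] , refl }) , complete , refl
  where
  complete : ∀ {π} → Free m π → sum π ≡ 0 → π ∈ [] ∷ []
  complete []      _ = here refl
  complete {c ∷ π} (m≤c ∷ _) s = contradiction
    (ℕₚ.≤-trans m≤c (ℕₚ.≤-trans (ℕₚ.m≤m+n c (sum π)) (ℕₚ.≤-reflexive s))) (ℕₚ.<⇒≱ 0<m)
count-Free-low {m} {suc n} n<m = [] , AllPairs.[] , (λ ()) , complete , refl
  where
  complete : ∀ {π} → Free m π → sum π ≡ suc n → π ∈ []
  complete {c ∷ π} (m≤c ∷ _) s = contradiction
    (ℕₚ.≤-trans m≤c (ℕₚ.≤-trans (ℕₚ.m≤m+n c (sum π)) (ℕₚ.≤-reflexive s))) (ℕₚ.<⇒≱ n<m)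

-- Solving the recurrences by induction

-- Removing a part m leaves r ≤ `fuel`, so with one unit of fuel less the invariant of the induction
-- holds for every positive new lower bound.
rest-< : ∀ {m r n fuel} d → m + r ≡ n → n < suc fuel + m → r < fuel + suc d
rest-< {m} {r} {fuel = fuel} d refl n< =
  ℕₚ.<-≤-trans (ℕₚ.+-cancelˡ-< m r (suc fuel) (subst (m + r <_) (ℕₚ.+-comm (suc fuel) m) n<))
    (subst (suc fuel ≤_) (sym (ℕₚ.+-suc fuel d)) (s≤s (ℕₚ.m≤m+n fuel d)))

mutual

  -- Induction on `fuel`, which bounds the excess of n over the least allowed part m. Each use of a
  -- recurrence either raises m with n fixed or removes m from n; at fuel 0, n < m and both sides
  -- are given by the series 1.
  count-Free-odd : ∀ fuel N {n} → n < fuel + (1 + N * 2) →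
    Count (Free (1 + N * 2)) n (S (N * 2) (1 + N * 4) (N * 6) n)
  count-Free-odd zero N {n} n<m = count-≡
    (sym (S-low {N * 2} {1 + N * 4} {N * 6} n≤ (ℕₚ.m≤n⇒m≤o+n 4 (ℕₚ.≤-trans n≤ (ℕₚ.*-monoʳ-≤ N (s≤s (s≤s z≤n)))))
                      (ℕₚ.m≤n⇒m≤o+n 11 (ℕₚ.≤-trans n≤ (ℕₚ.*-monoʳ-≤ N (s≤s (s≤s z≤n)))))))
    (count-Free-low n<m)
    where
    n≤ : n ≤ N * 2
    n≤ = ℕₚ.≤-pred n<m
  count-Free-odd (suc fuel) N {n} n< = count-≡ (sym (S-contiguousⁱ (N * 2) (1 + N * 4) (N * 6) n))
    (count-Free (1 + N * 2) (S (1 + N * 2) (1 + N * 4) (N * 6)) (S (2 + N * 2) (5 + N * 4) (6 + N * 6))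
      (count-Free-even fuel N (subst (n <_) (sym (ℕₚ.+-suc fuel (1 + N * 2))) n<))
      (λ r eq → count-After-odd (2∣⇒2∤suc (n∣m*n N))
        (count-Free-odd fuel (1 + N) (rest-< (2 + N * 2) eq n<))))

  count-Free-even : ∀ fuel N {n} → n < fuel + (2 + N * 2) →
    Count (Free (2 + N * 2)) n (S (1 + N * 2) (1 + N * 4) (N * 6) n)
  count-Free-even zero N {n} n<m = count-≡
    (sym (S-low {1 + N * 2} {1 + N * 4} {N * 6} n≤ (ℕₚ.m≤n⇒m≤o+n 3 (ℕₚ.≤-trans n≤ (s≤s (ℕₚ.*-monoʳ-≤ N (s≤s (s≤s z≤n))))))
                      (ℕₚ.≤-trans n≤ (ℕₚ.+-mono-≤ {1} {11} (s≤s z≤n) (ℕₚ.*-monoʳ-≤ N (s≤s (s≤s z≤n)))))))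
    (count-Free-low n<m)
    where
    n≤ : n ≤ 1 + N * 2
    n≤ = ℕₚ.≤-pred n<m
  count-Free-even (suc fuel) N {n} n< = count-≡ (sym (S-even (N * 2) (B≡ N) (C≡ N) n))
    (count-Free (2 + N * 2) (S (2 + N * 2) (5 + N * 4) (6 + N * 6))
      (S (4 + N * 2) (9 + N * 4) (12 + N * 6) ⊕ (3 + N * 2) ▷ S (5 + N * 2) (9 + N * 4) (12 + N * 6)
                                              ⊕ (4 + N * 2) ▷ S (6 + N * 2) (13 + N * 4) (18 + N * 6))
      (count-Free-odd fuel (1 + N) (subst (n <_) (sym (ℕₚ.+-suc fuel (2 + N * 2))) n<))
      (λ r eq → count-After-even
        (S (4 + N * 2) (9 + N * 4) (12 + N * 6)) (S (5 + N * 2) (9 + N * 4) (12 + N * 6))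
        (S (6 + N * 2) (13 + N * 4) (18 + N * 6))
        (n∣m*n (suc N))
        (count-Free-odd fuel (2 + N) (rest-< (4 + N * 2) eq n<))
        (λ r′ eq′ → count-Free-even fuel (2 + N)
           (ℕₚ.≤-<-trans (tail-≤ (3 + N * 2) eq′) (rest-< (5 + N * 2) eq n<)))
        (λ r′ eq′ → count-Free-odd fuel (3 + N)
           (ℕₚ.≤-<-trans (tail-≤ (4 + N * 2) eq′) (rest-< (6 + N * 2) eq n<)))))
    where
    B≡ : ∀ N → 1 + N * 4 ≡ 1 + (N * 2 + N * 2)
    B≡ = ℕ-Solver.solve-∀
    C≡ : ∀ N → N * 6 ≡ N * 2 + (N * 2 + N * 2)
    C≡ = ℕ-Solver.solve-∀
    tail-≤ : ∀ m {r r′} → m + r′ ≡ r → r′ ≤ r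
    tail-≤ m refl = ℕₚ.m≤n+m _ m

count-𝒫 : ∀ n → Count 𝒫 n (sum₃ exponent n)
count-𝒫 n = count-≡ (sym (sum₃-exponent n)) (count-⇔ after⇒𝒫 𝒫⇒after
  -- The added part 0 is even, so its continuations are counted by W₃ + qW₄ + q²W₅.
  (count-After-even (S 2 5 6) (S 3 5 6) (S 4 9 12) (divides 0 refl)
    (count-Free-odd (suc n) 1 (ℕₚ.m≤m+n (suc n) 3))
    (λ { r refl → count-Free-even (suc r) 1 (ℕₚ.m≤m+n (suc r) 4) })
    (λ { r refl → count-Free-odd (suc r) 2 (ℕₚ.m≤m+n (suc r) 5) })))

-- Summability of the two families

sum-q^ : ∀ {n} F → All (λ π → sum π ≡ n) F → sumℤ (map (λ π → (q^ sum π) n) F) ≡ ℤ.+ length F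
sum-q^ []      []         = refl
sum-q^ (π ∷ F) (refl ∷ s) = cong₂ ℤ._+_ (q^-refl (sum π)) (sum-q^ F s)

-- At n the monomial of π has coefficient 1 or 0 according as its sum is n or not, so the
-- enumeration of the lists of sum n serves as the support.
count⇒HasSum : ∀ {P f} → (∀ n → Count P n (f n)) → HasSum P (λ π → q^ sum π) f
count⇒HasSum count n with count n
... | F , u , sound , complete , len =
  F , u , All.tabulate (proj₁ ∘ sound) ,
  (λ π p π∉F → q^-≢ (λ n≡ → π∉F (complete p (sym n≡)))) ,
  trans (sum-q^ F (All.tabulate (proj₂ ∘ sound))) len

sumℤ-++ : ∀ xs ys → sumℤ (xs ++ ys) ≡ sumℤ xs ℤ.+ sumℤ ys
sumℤ-++ []       ys = sym (ℤₚ.+-identityˡ _)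
sumℤ-++ (x ∷ xs) ys = trans (cong (ℤ._+_ x) (sumℤ-++ xs ys)) (sym (ℤₚ.+-assoc x _ _))

sum-cartesianProduct : ∀ {A B : Set} (f : A × B → ℤ) xs ys →
  sumℤ (map f (cartesianProduct xs ys)) ≡ sumℤ (map (λ x → sumℤ (map (λ y → f (x , y)) ys)) xs)
sum-cartesianProduct f []       ys = refl
sum-cartesianProduct f (x ∷ xs) ys = begin
  sumℤ (map f (map (x ,_) ys ++ cartesianProduct xs ys))
    ≡⟨ cong sumℤ (Listₚ.map-++ f (map (x ,_) ys) _) ⟩
  sumℤ (map f (map (x ,_) ys) ++ map f (cartesianProduct xs ys))
    ≡⟨ sumℤ-++ (map f (map (x ,_) ys)) _ ⟩
  sumℤ (map f (map (x ,_) ys)) ℤ.+ sumℤ (map f (cartesianProduct xs ys))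
    ≡⟨ cong₂ ℤ._+_ (cong sumℤ (sym (Listₚ.map-∘ ys))) (sum-cartesianProduct f xs ys) ⟩
  _ ∎
  where open ≡-Reasoning

sum-upTo : ∀ {f g : ℕ → ℤ} → f ≗ g → ∀ K → sumℤ (map f (upTo K)) ≡ sumℤ (applyUpTo g K)
sum-upTo {f} p K = trans (cong sumℤ (Listₚ.map-upTo f K)) (sum-cong p K)

-- Under `Dominates`, every triple outside this cube has exponent above n.
box : ℕ → List (ℕ × ℕ × ℕ)
box n = cartesianProduct (upTo (suc n)) (cartesianProduct (upTo (suc n)) (upTo (suc n)))

sum-box : ∀ n {f} e → (∀ i j k → f (i , j , k) ≡ term e i j k n) → sumℤ (map f (box n)) ≡ sum₃ e n
sum-box n {f} e p = begin
  sumℤ (map f (box n))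
    ≡⟨ sum-cartesianProduct f (upTo (suc n)) (cartesianProduct (upTo (suc n)) (upTo (suc n))) ⟩
  sumℤ (map (λ i → sumℤ (map (λ jk → f (i , jk)) (cartesianProduct (upTo (suc n)) (upTo (suc n))))) (upTo (suc n)))
    ≡⟨ sum-upTo (λ i → trans
         (sum-cartesianProduct (λ jk → f (i , jk)) (upTo (suc n)) (upTo (suc n)))
         (sum-upTo (λ j → sum-upTo (p i j) (suc n)) (suc n))) (suc n) ⟩
  total (sum₂ e) n
    ≡⟨ sum₃-total e n ⟨
  sum₃ e n ∎
  where open ≡-Reasoning

sum₃-HasSum : ∀ {e f} → Dominates e → (∀ i j k → f (i , j , k) ≗ term e i j k) → HasSum U f (sum₃ e)
sum₃-HasSum {e} {f} dom p n =
  box n ,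
  Uniqueₚ.cartesianProduct⁺ unique (Uniqueₚ.cartesianProduct⁺ unique unique) ,
  All.tabulate (λ _ → tt) ,
  outside ,
  sum-box n {λ x → f x n} e (λ i j k → p i j k n)
  where
  unique = Uniqueₚ.upTo⁺ (suc n)
  outside : ∀ x → U x → x ∉ box n → f x n ≡ 0ℤ
  outside (i , j , k) _ x∉ with e i j k ℕₚ.≤? n
  ... | no e≰n  = trans (p i j k n) (term-< e i j k (ℕₚ.≰⇒> e≰n))
  ... | yes e≤n = contradiction
    (∈-cartesianProduct⁺ (inside (proj₁ (dom i j k)))
      (∈-cartesianProduct⁺ (inside (proj₁ (proj₂ (dom i j k)))) (inside (proj₂ (proj₂ (dom i j k)))))) x∉
    where
    inside : ∀ {m} → m ≤ e i j k → m ∈ upTo (suc n)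
    inside m≤e = ∈-upTo⁺ (s≤s (ℕₚ.≤-trans m≤e e≤n))

mainTheorem3 : ∃[ S ] (HasSum 𝒫 (λ π → q^ (sum π)) S × HasSum U summand S)
mainTheorem3 = sum₃ exponent , count⇒HasSum count-𝒫 , sum₃-HasSum exponent-dominates
  (λ i j k → ·▷-⊘ (sign k) (exponent i j k) (denominator i j k) (denominator-constant i j k))
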